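{- Let $m,n$ be non-negative integers with $n>m$. Let $m_1,n_1,m_2,n_2$ be non-negative integers with $m_1+n_1=m_2+n_2$ and $|m_1-n_1|<|m_2-n_2|$. Let $M$ and $N$ be any lists (possibly empty). Then (1) $\beta(M,m,n)\ge\beta(M,n,m)$, with equality if $M$ is empty; (2) $\beta(M,m_1,n_1,N)>\beta(M,m_2,n_2,N)$.
   Context: A list $(p_1,\dots,p_r)$ of non-negative integers ($r\ge1$) denotes the word $\mathbf c^{p_1}\mathbf d\mathbf c^{p_2}\mathbf d\cdots\mathbf d\mathbf c^{p_r}$ in non-commuting variables $\mathbf c$ (degree 1), $\mathbf d$ (degree 2); commas denote concatenation of lists. For a graded poset $P$ of rank $r+1$ with $\hat0,\hat1$ and $S\subseteq[r]$, $f_S$ counts chains $\hat0<x_1<\dots<x_j<\hat1$ with rank set $S$, $h_S=\sum_{T\subseteq S}(-1)^{|S-T|}f_T$, and the ab-index is $\sum_S h_S u_1\cdots u_r$ with $u_i=\mathbf b$ if $i\in S$, $\mathbf a$ otherwise. For Eulerian $P$ it is uniquely a polynomial $\Psi(P)$ in $\mathbf c=\mathbf a+\mathbf b$, $\mathbf d=\mathbf a\mathbf b+\mathbf b\mathbf a$. $B_{r+1}$ is the Boolean lattice of subsets of $[r+1]$. For a word $v$ of degree $r$, $\beta(v)$ is the coefficient of $v$ in $\Psi(B_{r+1})$; $\beta$ of a list is $\beta$ of the word it denotes. -}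

module Defs where

open import Data.Bool using (Bool; true; false; _∧_; _∨_; not; if_then_else_)
open import Data.Nat using (ℕ; zero; suc; _+_; _∸_; _≡ᵇ_; _≤ᵇ_)
open import Data.Nat as ℕ using ()
open import Data.Integer using (ℤ; +_; -_; _*_)
open import Data.Integer as ℤ using ()
open import Data.List using (List; []; _∷_; _++_; map; length; filterᵇ; replicate; concatMap)
open import Data.List as L using ()
open import Data.Nat.ListAction using () renaming (sum to sumℕ)
open import Relation.Binary.PropositionalEquality using (_≡_)

-- ab-words: lists of Bool, false = a, true = b.
-- All ab-words of length n.
allWords : ℕ → List (List Bool)
allWords zero    = [] ∷ []
allWords (suc n) = map (false ∷_) (allWords n) ++ map (true ∷_) (allWords n)

eqWord : List Bool → List Bool → Bool
eqWord [] [] = true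
eqWord (true ∷ xs) (true ∷ ys) = eqWord xs ys
eqWord (false ∷ xs) (false ∷ ys) = eqWord xs ys
eqWord _ _ = false

card : List Bool → ℕ
card [] = 0
card (true ∷ xs) = suc (card xs)
card (false ∷ xs) = card xs

subsetᵇ : List Bool → List Bool → Bool
subsetᵇ [] [] = true
subsetᵇ (x ∷ xs) (y ∷ ys) = (not x ∨ y) ∧ subsetᵇ xs ys
subsetᵇ _ _ = false

ranksFrom : ℕ → List Bool → List ℕ
ranksFrom i [] = []
ranksFrom i (true ∷ xs) = i ∷ ranksFrom (suc i) xs
ranksFrom i (false ∷ xs) = ranksFrom (suc i) xs

ranksOf : List Bool → List ℕ
ranksOf = ranksFrom 1

-- Elements of the Boolean lattice B_N: subsets of [N] as characteristic words of length N.
-- chainCount N x ks: number of chains x < y_1 < ... < y_j in B_N with rank(y_i) = k_i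
-- (ks increasing; strictness follows from strictly increasing ranks).
chainCount : ℕ → List Bool → List ℕ → ℕ
chainCount N x [] = 1
chainCount N x (k ∷ ks) =
  sumℕ (map (λ y → chainCount N y ks)
             (filterᵇ (λ y → subsetᵇ x y ∧ (card y ≡ᵇ k)) (allWords N)))

-- flag f-vector of B_{r+1}, S ⊆ [r] encoded as a word of length r:
-- number of chains 0̂ < x_1 < ... < x_j < 1̂ with rank set S.
fB : List Bool → ℕ
fB S = chainCount (suc (length S)) (replicate (suc (length S)) false) (ranksOf S)

sign : ℕ → ℤ
sign zero = + 1
sign (suc zero) = - (+ 1)
sign (suc (suc k)) = sign k

hB : List Bool → ℤ
hB S = sumℤ (map (λ T → sign (card S ∸ card T) * + fB T)
                 (filterᵇ (λ T → subsetᵇ T S) (allWords (length S))))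
  where
  sumℤ : List ℤ → ℤ
  sumℤ = L.foldr ℤ._+_ (+ 0)

-- The ab-index of B_{r+1}: coefficient of the ab-word u_1…u_r (u_i = b iff i ∈ S) is h_S.
abIndexB : List Bool → ℤ
abIndexB w = hB w

-- cd-words: a list (p_1,…,p_r) denotes c^{p_1} d c^{p_2} d ⋯ d c^{p_r}.
data Letter : Set where
  C D : Letter

cs : ℕ → List Letter
cs n = replicate n C

letters : List ℕ → List Letter
letters [] = []
letters (p ∷ []) = cs p
letters (p ∷ q ∷ ps) = cs p ++ D ∷ letters (q ∷ ps)

degree : List ℕ → ℕ
degree ps = sumℕ (map (λ { C → 1 ; D → 2 }) (letters ps))

-- expansion into ab-words (with multiplicity), c = a + b, d = ab + ba
expandLetters : List Letter → List (List Bool)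
expandLetters [] = [] ∷ []
expandLetters (C ∷ r) = map (false ∷_) (expandLetters r) ++ map (true ∷_) (expandLetters r)
expandLetters (D ∷ r) = map (λ x → false ∷ true ∷ x) (expandLetters r)
                     ++ map (λ x → true ∷ false ∷ x) (expandLetters r)

abCoeff : List ℕ → List Bool → ℕ
abCoeff v w = length (filterᵇ (eqWord w) (expandLetters (letters v)))

-- all (nonempty) lists (p_1,…,p_r) denoting cd-words of degree n
-- (fuel-indexed helper; fuel ≥ n suffices)
cdWordsF : ℕ → ℕ → List (List ℕ)
cdWordsF zero n = (n ∷ []) ∷ []
cdWordsF (suc fuel) n =
  (n ∷ []) ∷ concatMap (λ p → map (p ∷_) (cdWordsF fuel (n ∸ 2 ∸ p)))
                       (filterᵇ (λ p → (p + 2) ≤ᵇ n) (L.upTo n))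

cdWords : ℕ → List (List ℕ)
cdWords n = cdWordsF n n

-- β : (lists → ℤ) is the cd-index coefficient function of the Boolean lattices:
-- for every r and every ab-word w of length r, the ab-expansion of
-- Σ_{v of degree r} β(v) v has coefficient of w equal to that of the ab-index of B_{r+1}.
-- (By uniqueness of the cd-index this determines β on all nonempty lists.)
IsBooleanCdIndex : (List ℕ → ℤ) → Set
IsBooleanCdIndex β =
  ∀ (w : List Bool) →
    L.foldr ℤ._+_ (+ 0) (map (λ v → β v * + abCoeff v w) (cdWords (length w)))
      ≡ abIndexB w

{-# OPTIONS --safe #-}
module Submission where

open import Defs
open import Algebra.Bundles using (AbelianGroup)
open import Algebra.Structures using (IsMonoid)
open import Data.Bool using (Bool; true; false; _∧_; _xor_; if_then_else_)
open import Data.Bool.Properties using (∧-zeroʳ)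
open import Data.Empty using (⊥-elim)
import Data.Integer as ℤ
import Data.Integer.Properties as ℤ
import Data.Integer.Tactic.RingSolver as ℤ using (solve-∀)
open import Data.List
  using (List; []; _∷_; _++_; reverse; map; foldr; filterᵇ; length; replicate; concatMap; upTo; applyUpTo)
open import Data.List.Properties
  using (++-assoc; ++-identityʳ; unfold-reverse; reverse-++; reverse-involutive; length-replicate; map-∘; map-upTo)
open import Data.Nat
open import Data.Nat.Properties
open import Data.Nat.Tactic.RingSolver using (solve-∀)
open import Data.Product using (_×_; _,_; ∃)
open import Data.Sum using (_⊎_; inj₁; inj₂)
open import Function using (_∘_)
open import Relation.Binary.PropositionalEquality
open import Algebra.Properties.Group (AbelianGroup.group ℤ.+-0-abelianGroup) using (∙-cancelˡ; ∙-cancelʳ)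

-- For words u and v, the coproduct of the cd-index of a Boolean lattice gives
--   binom · β(u) β(v) = 2 β(u c v) + β(u d v′) + β(u′ d v),   where u = u′ c and v = c v′,
-- which is proved by induction from the derivation recursion (β sums over the lists obtained by lowering
-- a part by one or by merging adjacent parts p, q into p + q + 1).  The same induction gives
--   β(p , r) = β(p - 1 , r) + Σ binom · β(L) β(R),   summed over the splittings (L , R) of (p , r).
-- In the second recursion all terms for (M , m , n , N) compare well by induction on the degree, except
-- possibly binom · β(M , m) β(n , N); but up to a simple factor the coproduct identity turns this product
-- into values of β in a degree smaller by one, which are again compared by induction.  The factor is
-- favourable if n₂ is the least of m₁, n₁, m₂, n₂, and reversing lists reduces to this case unless N is
-- empty; then the gain in the term β(M) β(m , n) compensates the loss.  For the first inequality the
-- exceptional term is controlled by (n + 1) β(M , n + 1) ≤ (deg (M , n) + 2) β(M , n).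

-- Binomial coefficients

-- Everything is proved for `β₀`, which the derivation recursion defines with values in ℕ, so that
-- sums can be compared term by term. That `β₀` is the cd-index is then checked on flag vectors:
-- choosing the element of lowest rank first gives h(a^j b w) + h(a^(j+1) w) = binom · h(w), and the
-- coproduct identity with u = c^j gives the same relation for the ab-expansion of `β₀`. Together
-- with the value 1 on powers of a, this relation determines all coefficients.
--
-- The exceptional product is the obstacle because its binomial and both its factors change with the
-- pair, whereas in every other term the pair stays together. The binomial of the coproduct identity
-- has a second argument larger by one. Absorption therefore makes the product equal to the
-- coproduct sum times deg (n , N) + 1, divided by a number that depends on m + n only; the
-- numerator is the factor that favours the larger second entry.

-- binom i j is the binomial coefficient "i + j choose i", indexed so that no subtraction occurs.
binom : ℕ → ℕ → ℕ
binom zero    j       = 1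
binom (suc i) zero    = 1
binom (suc i) (suc j) = binom i (suc j) + binom (suc i) j

binom-zeroʳ : ∀ i → binom i 0 ≡ 1
binom-zeroʳ zero    = refl
binom-zeroʳ (suc i) = refl

binom-! : ∀ i j → binom i j * (i ! * j !) ≡ (i + j) !
binom-! zero j = trans (+-identityʳ _) (+-identityʳ _)
binom-! (suc i) zero = begin
  1 * ((suc i) ! * 1)  ≡⟨ trans (+-identityʳ _) (*-identityʳ _) ⟩
  (suc i) !            ≡⟨ cong _! (sym (+-identityʳ (suc i))) ⟩
  (suc i + 0) !        ∎
  where open ≡-Reasoning
binom-! (suc i) (suc j) = begin
  (x + y) * ((suc i * i !) * (suc j * j !))
    ≡⟨ regroup x y (suc i) (i !) (suc j) (j !) ⟩
  suc i * (x * (i ! * (suc j) !)) + suc j * (y * ((suc i) ! * j !))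
    ≡⟨ cong₂ (λ u v → suc i * u + suc j * v) (binom-! i (suc j)) (binom-! (suc i) j) ⟩
  suc i * (i + suc j) ! + suc j * (suc i + j) !
    ≡⟨ cong (λ n → suc i * (i + suc j) ! + suc j * n !) (sym (+-suc i j)) ⟩
  suc i * (i + suc j) ! + suc j * (i + suc j) !
    ≡⟨ *-distribʳ-+ ((i + suc j) !) (suc i) (suc j) ⟨
  (suc i + suc j) ! ∎
  where
  open ≡-Reasoning
  x = binom i (suc j)
  y = binom (suc i) j
  regroup : ∀ x y a p b q →
    (x + y) * ((a * p) * (b * q)) ≡ a * (x * (p * (b * q))) + b * (y * ((a * p) * q))
  regroup = solve-∀

binom-comm : ∀ i j → binom i j ≡ binom j i
binom-comm zero    j       = sym (binom-zeroʳ j)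
binom-comm (suc i) zero    = refl
binom-comm (suc i) (suc j) =
  trans (cong₂ _+_ (binom-comm i (suc j)) (binom-comm (suc i) j)) (+-comm (binom (suc j) i) _)

binom-pos : ∀ i j → 0 < binom i j
binom-pos zero    j       = ≤-refl
binom-pos (suc i) zero    = ≤-refl
binom-pos (suc i) (suc j) = m≤n⇒m≤n+o _ (binom-pos i (suc j))

binom-absorbʳ : ∀ i j → suc j * binom i (suc j) ≡ suc (i + j) * binom i j
binom-absorbʳ i j = *-cancelʳ-≡ _ _ (i ! * j !) {{i !* j !≢0}} (begin
  suc j * binom i (suc j) * (i ! * j !)     ≡⟨ regroup (suc j) (binom i (suc j)) (i !) (j !) ⟩
  binom i (suc j) * (i ! * (suc j) !)       ≡⟨ binom-! i (suc j) ⟩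
  (i + suc j) !                             ≡⟨ cong _! (+-suc i j) ⟩
  suc (i + j) * (i + j) !                   ≡⟨ cong (suc (i + j) *_) (sym (binom-! i j)) ⟩
  suc (i + j) * (binom i j * (i ! * j !))   ≡⟨ *-assoc (suc (i + j)) (binom i j) _ ⟨
  suc (i + j) * binom i j * (i ! * j !)     ∎)
  where
  open ≡-Reasoning
  regroup : ∀ a x p q → a * x * (p * q) ≡ x * (p * (a * q))
  regroup = solve-∀

binom-absorbˡ : ∀ i j → suc i * binom (suc i) j ≡ suc (i + j) * binom i j
binom-absorbˡ i j = begin
  suc i * binom (suc i) j   ≡⟨ cong (suc i *_) (binom-comm (suc i) j) ⟩
  suc i * binom j (suc i)   ≡⟨ binom-absorbʳ j i ⟩
  suc (j + i) * binom j i   ≡⟨ cong₂ (λ n x → suc n * x) (+-comm j i) (binom-comm j i) ⟩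
  suc (i + j) * binom i j   ∎
  where open ≡-Reasoning

binom-trinomial : ∀ i j k → binom (i + j) k * binom i j ≡ binom i (j + k) * binom j k
binom-trinomial i j k = *-cancelʳ-≡ _ _ (i ! * j ! * k !) (begin
  binom (i + j) k * binom i j * (i ! * j ! * k !)
    ≡⟨ regroup₁ (binom (i + j) k) (binom i j) (i !) (j !) (k !) ⟩
  binom (i + j) k * (binom i j * (i ! * j !) * k !)
    ≡⟨ cong (λ x → binom (i + j) k * (x * k !)) (binom-! i j) ⟩
  binom (i + j) k * ((i + j) ! * k !)
    ≡⟨ binom-! (i + j) k ⟩
  (i + j + k) !
    ≡⟨ cong _! (+-assoc i j k) ⟩
  (i + (j + k)) !
    ≡⟨ binom-! i (j + k) ⟨
  binom i (j + k) * (i ! * (j + k) !)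
    ≡⟨ cong (λ x → binom i (j + k) * (i ! * x)) (binom-! j k) ⟨
  binom i (j + k) * (i ! * (binom j k * (j ! * k !)))
    ≡⟨ regroup₂ (binom i (j + k)) (binom j k) (i !) (j !) (k !) ⟩
  binom i (j + k) * binom j k * (i ! * j ! * k !) ∎)
  where
  open ≡-Reasoning
  instance _ = m*n≢0 (i ! * j !) (k !) {{i !* j !≢0}} {{k !≢0}}
  regroup₁ : ∀ x y p q r → x * y * (p * q * r) ≡ x * (y * (p * q) * r)
  regroup₁ = solve-∀
  regroup₂ : ∀ x y p q r → x * (p * (y * (q * r))) ≡ x * y * (p * q * r)
  regroup₂ = solve-∀

binom-step-≤ : ∀ i j → i ≤ j → binom i (suc j) ≤ binom (suc i) j
binom-step-≤ i j i≤j = *-cancelˡ-≤ (suc j) (begin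
  suc j * binom i (suc j)   ≡⟨ binom-absorbʳ i j ⟩
  suc (i + j) * binom i j   ≡⟨ binom-absorbˡ i j ⟨
  suc i * binom (suc i) j   ≤⟨ *-monoˡ-≤ (binom (suc i) j) (s≤s i≤j) ⟩
  suc j * binom (suc i) j   ∎)
  where open ≤-Reasoning

-- Each step moves towards the middle of the row. Once i = j the two sides are mirror images.
binom-shift-≤ : ∀ d i j → i ≤ j → binom i (d + j) ≤ binom (d + i) j
binom-shift-≤ zero    i j i≤j = ≤-refl
binom-shift-≤ (suc d) i j i≤j with m≤n⇒m<n∨m≡n i≤j
... | inj₂ refl = ≤-reflexive (binom-comm i (suc d + i))
... | inj₁ i<j  = begin
  binom i (suc (d + j))    ≤⟨ binom-step-≤ i (d + j) (≤-trans i≤j (m≤n+m j d)) ⟩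
  binom (suc i) (d + j)    ≤⟨ binom-shift-≤ d (suc i) j i<j ⟩
  binom (d + suc i) j      ≡⟨ cong (λ n → binom n j) (+-suc d i) ⟩
  binom (suc d + i) j      ∎
  where open ≤-Reasoning

binom-unimodal : ∀ {i j i′ j′} → i + j ≡ i′ + j′ → i ≤ i′ → i ≤ j′ → binom i j ≤ binom i′ j′
binom-unimodal {i} {j} {i′} {j′} eq i≤i′ i≤j′ =
  subst₂ (λ a b → binom i a ≤ binom b j′) (sym j≡) (m∸n+n≡m i≤i′) (binom-shift-≤ (i′ ∸ i) i j′ i≤j′)
  where
  open ≡-Reasoning
  j≡ : j ≡ i′ ∸ i + j′
  j≡ = +-cancelˡ-≡ i _ _ (begin
    i + j                 ≡⟨ eq ⟩
    i′ + j′               ≡⟨ cong (_+ j′) (m+[n∸m]≡n i≤i′) ⟨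
    i + (i′ ∸ i) + j′     ≡⟨ +-assoc i (i′ ∸ i) j′ ⟩
    i + (i′ ∸ i + j′)     ∎)

-- Functionals on lists and the derivation

-- `deg` is the degree of the word; `size` counts a d after every part, the last one included. It is
-- what a list contributes as a proper prefix, so `deg-++` needs no subtraction.
deg size : List ℕ → ℕ
size []      = 0
size (p ∷ r) = suc (suc (p + size r))
deg []      = 0
deg (p ∷ r) = p + size r

size-++ : ∀ u v → size (u ++ v) ≡ size u + size v
size-++ []      v = refl
size-++ (p ∷ u) v = cong (2 +_) (trans (cong (p +_) (size-++ u v)) (sym (+-assoc p _ _)))

deg-++ : ∀ u q r → deg (u ++ q ∷ r) ≡ size u + deg (q ∷ r)
deg-++ []      q r = refl
deg-++ (p ∷ u) q r = begin
  p + size (u ++ q ∷ r)               ≡⟨ cong (p +_) (size-++ u (q ∷ r)) ⟩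
  p + (size u + (2 + deg (q ∷ r)))    ≡⟨ regroup p (size u) (deg (q ∷ r)) ⟩
  2 + (p + size u) + deg (q ∷ r)      ∎
  where
  open ≡-Reasoning
  regroup : ∀ p s d → p + (s + (2 + d)) ≡ 2 + (p + s) + d
  regroup = solve-∀

-- The part to be lowered is an argument of its own, so that composing φ with a prefix lowers an
-- inner part. A part 0 contains no c, and its term is absent.
dec : (List ℕ → ℕ) → ℕ → List ℕ → ℕ
dec φ zero    r = 0
dec φ (suc p) r = φ (p ∷ r)

decHead : (List ℕ → ℕ) → List ℕ → ℕ
decHead φ []      = 0
decHead φ (p ∷ r) = dec φ p r

-- The transpose of v ↦ G(v) + v c, where G is the Ehrenborg–Readdy derivation c ↦ d, d ↦ cd.
∂ : (List ℕ → ℕ) → List ℕ → ℕ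
∂ φ []          = 0
∂ φ (p ∷ [])    = dec φ p []
∂ φ (p ∷ q ∷ r) = dec φ p (q ∷ r) + φ (suc (p + q) ∷ r) + ∂ (φ ∘ (p ∷_)) (q ∷ r)

-- The operators `∂`, `split` and `expandℕ` only add up values of a functional. Any relation that is
-- compatible with 0 and + therefore passes through them; congruence, scaling and monotonicity are
-- all instances.
record Additive (_~_ : ℕ → ℕ → Set) : Set where
  field
    zero~ : 0 ~ 0
    plus~ : ∀ {a b c d} → a ~ b → c ~ d → (a + c) ~ (b + d)

≡-additive : Additive _≡_
≡-additive = record { zero~ = refl ; plus~ = cong₂ _+_ }

≤-additive : Additive _≤_
≤-additive = record { zero~ = z≤n ; plus~ = +-mono-≤ }

scaled-additive : ∀ k → Additive (λ x y → x ≡ k * y)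
scaled-additive k = record
  { zero~ = sym (*-zeroʳ k)
  ; plus~ = λ {a} {b} {c} {d} p q → trans (cong₂ _+_ p q) (sym (*-distribˡ-+ k b d)) }

scaled-≤-additive : ∀ k l → Additive (λ x y → k * x ≤ l * y)
scaled-≤-additive k l = record
  { zero~ = ≤-reflexive (trans (*-zeroʳ k) (sym (*-zeroʳ l)))
  ; plus~ = λ {a} {b} {c} {d} p q → subst₂ _≤_ (sym (*-distribˡ-+ k a c)) (sym (*-distribˡ-+ l b d)) (+-mono-≤ p q) }

deg-merge : ∀ p q r → suc (deg (suc (p + q) ∷ r)) ≡ deg (p ∷ q ∷ r)
deg-merge p q r = regroup p q (size r)
  where
  regroup : ∀ p q s → suc (suc (p + q) + s) ≡ p + suc (suc (q + s))
  regroup = solve-∀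

module _ {_~_ : ℕ → ℕ → Set} (additive : Additive _~_) where
  open Additive additive

  -- The values that enter `∂ φ w` are taken at non-empty lists of degree exactly one less. This is
  -- what lets an induction on the degree be applied under `∂`.
  ∂-rel : ∀ {φ ψ} w → (∀ q s → suc (deg (q ∷ s)) ≡ deg w → φ (q ∷ s) ~ ψ (q ∷ s)) → ∂ φ w ~ ∂ ψ w
  ∂-rel []              h = zero~
  ∂-rel (zero ∷ [])     h = zero~
  ∂-rel (suc p ∷ [])    h = h p [] refl
  ∂-rel {φ} {ψ} (p ∷ q ∷ r) h =
    plus~ (plus~ (lowered p h) (h _ _ (deg-merge p q r)))
          (∂-rel (q ∷ r) (λ q′ s eq → h p (q′ ∷ s) (trans (sym (+-suc p _)) (cong (λ n → p + suc (suc n)) eq))))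
    where
    lowered : ∀ p → (∀ q′ s → suc (deg (q′ ∷ s)) ≡ deg (p ∷ q ∷ r) → φ (q′ ∷ s) ~ ψ (q′ ∷ s)) →
              dec φ p (q ∷ r) ~ dec ψ p (q ∷ r)
    lowered zero    h = zero~
    lowered (suc p) h = h p (q ∷ r) refl

∂-cong : ∀ {φ ψ} w → (∀ q s → φ (q ∷ s) ≡ ψ (q ∷ s)) → ∂ φ w ≡ ∂ ψ w
∂-cong w h = ∂-rel ≡-additive w (λ q s _ → h q s)

dec-+ : ∀ φ ψ p r → dec (λ v → φ v + ψ v) p r ≡ dec φ p r + dec ψ p r
dec-+ φ ψ zero    r = refl
dec-+ φ ψ (suc p) r = refl

interchange₂ : ∀ a b c d → (a + b) + (c + d) ≡ (a + c) + (b + d)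
interchange₂ = solve-∀

∂-+ : ∀ φ ψ w → ∂ (λ v → φ v + ψ v) w ≡ ∂ φ w + ∂ ψ w
∂-+ φ ψ []          = refl
∂-+ φ ψ (p ∷ [])    = dec-+ φ ψ p []
∂-+ φ ψ (p ∷ q ∷ r) =
  trans (cong₂ (λ x y → x + (φ v + ψ v) + y) (dec-+ φ ψ p (q ∷ r)) (∂-+ (φ ∘ (p ∷_)) (ψ ∘ (p ∷_)) (q ∷ r)))
        (regroup (dec φ p (q ∷ r)) (dec ψ p (q ∷ r)) (φ v) (ψ v) _ _)
  where
  v = suc (p + q) ∷ r
  regroup : ∀ a b c d e f → a + b + (c + d) + (e + f) ≡ a + c + e + (b + d + f)
  regroup = solve-∀

∂-0 : ∀ w → ∂ (λ _ → 0) w ≡ 0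
∂-0 w = ∂-rel (scaled-additive 0) {ψ = λ _ → 0} w (λ _ _ _ → refl)

unit : List ℕ → ℕ
unit (zero ∷ []) = 1
unit _           = 0

-- The number is the degree at which the functional is meant to be evaluated; it makes the
-- derivation recursion structural.
βAt : ℕ → List ℕ → ℕ
βAt zero    = unit
βAt (suc n) = ∂ (βAt n)

β₀ : List ℕ → ℕ
β₀ w = βAt (deg w) w

β₀-∂-of-deg : ∀ n w → deg w ≡ suc n → ∂ (βAt n) w ≡ ∂ β₀ w
β₀-∂-of-deg n w eq = ∂-rel ≡-additive w (λ q s eq′ → cong (λ k → βAt k (q ∷ s)) (sym (suc-injective (trans eq′ eq))))

-- The recursion `β₀` = `∂ β₀` fails only at the empty word. Each constructor collects all the
-- values that a Leibniz rule mentions, so that rewriting settles each case.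
data UnitView (w : List ℕ) : Set where
  is-unit  : deg w ≡ 0 → unit w ≡ 1 → ∂ β₀ w ≡ 0 → β₀ w ≡ 1 → UnitView w
  non-unit : ∀ n → deg w ≡ suc n → unit w ≡ 0 → β₀ w ≡ ∂ β₀ w → UnitView w

unitView : ∀ p r → UnitView (p ∷ r)
unitView zero    []      = is-unit refl refl refl refl
unitView zero    (q ∷ r) = non-unit _ refl refl (β₀-∂-of-deg _ (zero ∷ q ∷ r) refl)
unitView (suc p) r       = non-unit _ refl refl (β₀-∂-of-deg _ (suc p ∷ r) refl)

β₀-∂ : ∀ p r → β₀ (p ∷ r) ≡ ∂ β₀ (p ∷ r) + unit (p ∷ r)
β₀-∂ p r with unitView p r
... | is-unit  _ u≡1 ∂≡0 β≡1   = trans β≡1 (sym (cong₂ _+_ ∂≡0 u≡1))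
... | non-unit _ _   u≡0 β≡∂   = trans β≡∂ (sym (trans (cong (∂ β₀ (p ∷ r) +_) u≡0) (+-identityʳ _)))

β₀-∂-long : ∀ p q r → β₀ (p ∷ q ∷ r) ≡ ∂ β₀ (p ∷ q ∷ r)
β₀-∂-long p q r = trans (β₀-∂ p (q ∷ r)) (trans (cong (∂ β₀ (p ∷ q ∷ r) +_) (unit-long p)) (+-identityʳ _))
  where
  unit-long : ∀ p → unit (p ∷ q ∷ r) ≡ 0
  unit-long zero    = refl
  unit-long (suc p) = refl

β₀-single : ∀ p → β₀ (p ∷ []) ≡ 1
β₀-single zero    = refl
β₀-single (suc p) = trans (β₀-∂ (suc p) []) (trans (+-identityʳ _) (β₀-single p))

-- Merging the first two parts is always possible and shortens the list.
β₀-pos : ∀ p r → 0 < β₀ (p ∷ r)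
β₀-pos p []      = ≤-reflexive (sym (β₀-single p))
β₀-pos p (q ∷ r) = begin
  1                                                   ≤⟨ β₀-pos (suc (p + q)) r ⟩
  β₀ (suc (p + q) ∷ r)                                ≤⟨ m≤n+m _ (dec β₀ p (q ∷ r)) ⟩
  dec β₀ p (q ∷ r) + β₀ (suc (p + q) ∷ r)             ≤⟨ m≤m+n _ _ ⟩
  ∂ β₀ (p ∷ q ∷ r)                                    ≡⟨ β₀-∂-long p q r ⟨
  β₀ (p ∷ q ∷ r)                                      ∎
  where open ≤-Reasoning

-- The Leibniz rule behind the product formulas: the binomial convolution of β₀ with itself obeys
-- Pascal's rule up to the boundary terms where one factor is the empty word.
binom-Leibniz : ∀ p r q s → let u = p ∷ r; v = q ∷ s in
  binom (deg u) (suc (deg v)) * (∂ β₀ u * β₀ v) + binom (suc (deg u)) (deg v) * (β₀ u * ∂ β₀ v)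
    + unit v * β₀ u + unit u * β₀ v
  ≡ binom (suc (deg u)) (suc (deg v)) * (β₀ u * β₀ v)
binom-Leibniz p r q s with unitView p r | unitView q s
... | is-unit a u x y | is-unit b v z t
  rewrite a | u | x | y | b | v | z | t = refl
... | is-unit a u x y | non-unit n b v z
  rewrite a | u | x | y | b | v | z = regroup (binom 1 (suc n)) (∂ β₀ (q ∷ s))
  where
  regroup : ∀ c e → 0 + c * (e + 0) + 0 + (e + 0) ≡ (1 + c) * (e + 0)
  regroup = solve-∀
... | non-unit m a u x | is-unit b v z t
  rewrite a | u | x | b | v | z | t = regroup (binom (suc m) 1) (∂ β₀ (p ∷ r))
  where
  regroup : ∀ c e → c * (e * 1) + 1 * (e * 0) + (e + 0) + 0 ≡ (c + 1) * (e * 1)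
  regroup = solve-∀
... | non-unit m a u x | non-unit n b v z
  rewrite a | u | x | b | v | z = regroup (binom (suc m) (suc (suc n))) (binom (suc (suc m)) (suc n)) _
  where
  regroup : ∀ c d e → c * e + d * e + 0 + 0 ≡ (c + d) * e
  regroup = solve-∀

-- The variant for the binomials of the product recursion. Only u contributes a boundary term: if v
-- is the empty word, then `∂ β₀ v` is 0, which makes `pred` harmless, and the remaining binomials
-- are both 1.
binom-Leibniz-pred : ∀ p r q s → let u = p ∷ r; v = q ∷ s in
  binom (deg u) (deg v) * (∂ β₀ u * β₀ v) + binom (suc (deg u)) (pred (deg v)) * (β₀ u * ∂ β₀ v)
    + unit u * β₀ v
  ≡ binom (suc (deg u)) (deg v) * (β₀ u * β₀ v)
binom-Leibniz-pred p r q s with unitView p r | unitView q s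
... | is-unit a u x y | is-unit b v z t
  rewrite a | u | x | y | b | z | t = refl
... | is-unit a u x y | non-unit n b v z
  rewrite a | u | x | y | b | z = regroup (binom 1 n) (∂ β₀ (q ∷ s))
  where
  regroup : ∀ c e → c * (e + 0) + (e + 0) ≡ (1 + c) * (e + 0)
  regroup = solve-∀
... | non-unit m a u x | is-unit b v z t
  rewrite a | u | x | b | z | t = regroup (∂ β₀ (p ∷ r))
  where
  regroup : ∀ e → 1 * (e * 1) + 1 * (e * 0) + 0 ≡ 1 * (e * 1)
  regroup = solve-∀
... | non-unit m a u x | non-unit n b v z
  rewrite a | u | x | b | z = regroup (binom (suc m) (suc n)) (binom (suc (suc m)) n) _
  where
  regroup : ∀ c d e → c * e + d * e + 0 ≡ (c + d) * e
  regroup = solve-∀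

-- The coproduct identity

-- joint φ u v sums φ over the words w whose coproduct contains u ⊗ v, with multiplicity, where the
-- coproduct is the one with c ↦ 2 (1 ⊗ 1) and d ↦ 1 ⊗ c + c ⊗ 1: these are u c v (twice),
-- u d v′ if v = c v′, and u′ d v if u = u′ c.
joint : (List ℕ → ℕ) → List ℕ → List ℕ → ℕ
joint φ (p ∷ [])     (q ∷ r) = 2 * φ (suc (p + q) ∷ r) + dec (φ ∘ (p ∷_)) q r + dec φ p (q ∷ r)
joint φ (p ∷ p′ ∷ u) v       = joint (φ ∘ (p ∷_)) (p′ ∷ u) v
joint φ _            _       = 0

joint-cong : ∀ {φ ψ} u v → (∀ q s → φ (q ∷ s) ≡ ψ (q ∷ s)) → joint φ u v ≡ joint ψ u v
joint-cong []           v           h = refl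
joint-cong (p ∷ [])     []          h = refl
joint-cong (p ∷ p′ ∷ u) v           h = joint-cong (p′ ∷ u) v (λ q s → h p (q ∷ s))
joint-cong (zero ∷ [])  (zero ∷ r)  h = cong (λ x → 2 * x + 0 + 0) (h _ r)
joint-cong (zero ∷ [])  (suc q ∷ r) h = cong₂ (λ x y → 2 * x + y + 0) (h _ r) (h _ _)
joint-cong (suc p ∷ []) (zero ∷ r)  h = cong₂ (λ x y → 2 * x + 0 + y) (h _ r) (h _ _)
joint-cong (suc p ∷ []) (suc q ∷ r) h = cong₂ _+_ (cong₂ (λ x y → 2 * x + y) (h _ r) (h _ _)) (h _ _)

joint-+ : ∀ φ ψ u v → joint (λ w → φ w + ψ w) u v ≡ joint φ u v + joint ψ u v
joint-+ φ ψ []           v       = refl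
joint-+ φ ψ (p ∷ [])     []      = refl
joint-+ φ ψ (p ∷ p′ ∷ u) v       = joint-+ (φ ∘ (p ∷_)) (ψ ∘ (p ∷_)) (p′ ∷ u) v
joint-+ φ ψ (p ∷ [])     (q ∷ r) =
  trans (cong₂ (λ x y → 2 * (φ w + ψ w) + x + y) (dec-+ (φ ∘ (p ∷_)) (ψ ∘ (p ∷_)) q r) (dec-+ φ ψ p (q ∷ r)))
        (regroup (φ w) (ψ w) (dec (φ ∘ (p ∷_)) q r) _ (dec φ p (q ∷ r)) _)
  where
  w = suc (p + q) ∷ r
  regroup : ∀ a b c d e f → 2 * (a + b) + (c + d) + (e + f) ≡ 2 * a + c + e + (2 * b + d + f)
  regroup = solve-∀

joint-0 : ∀ u v → joint (λ _ → 0) u v ≡ 0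
joint-0 []           v           = refl
joint-0 (p ∷ [])     []          = refl
joint-0 (p ∷ p′ ∷ u) v           = joint-0 (p′ ∷ u) v
joint-0 (zero ∷ [])  (zero ∷ r)  = refl
joint-0 (zero ∷ [])  (suc q ∷ r) = refl
joint-0 (suc p ∷ []) (zero ∷ r)  = refl
joint-0 (suc p ∷ []) (suc q ∷ r) = refl

-- Every list evaluated by `joint` has degree `deg u + deg v + 1`, hence is not the empty word.
joint-unit : ∀ u v → joint unit u v ≡ 0
joint-unit []             v                = refl
joint-unit (p ∷ [])       []               = refl
joint-unit (zero ∷ p′ ∷ u) v = trans (joint-cong (p′ ∷ u) v (λ _ _ → refl)) (joint-0 (p′ ∷ u) v)
joint-unit (suc p ∷ p′ ∷ u) v = trans (joint-cong (p′ ∷ u) v (λ _ _ → refl)) (joint-0 (p′ ∷ u) v)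
joint-unit (zero ∷ [])  (zero ∷ r)  = refl
joint-unit (zero ∷ [])  (suc q ∷ r) = refl
joint-unit (suc zero ∷ [])    (zero ∷ r)  = refl
joint-unit (suc (suc p) ∷ []) (zero ∷ r)  = refl
joint-unit (suc zero ∷ [])    (suc q ∷ r) = refl
joint-unit (suc (suc p) ∷ []) (suc q ∷ r) = refl

-- The value at the empty list is a default. With it, `∂ φ (p ∷ x)` becomes a sum of three
-- functionals of a non-empty x.
merge : ℕ → List ℕ → List ℕ
merge p []      = []
merge p (q ∷ r) = suc (p + q) ∷ r

-- If the left list is the single part 0, it ends in no c, but merging p into it creates one.
-- Turning this c into a d gives `p ∷ q ∷ r`, which is the correction.
joint-merge : ∀ φ p p′ u q r →
  joint (φ ∘ merge p) (p′ ∷ u) (q ∷ r) + unit (p′ ∷ u) * φ (p ∷ q ∷ r) ≡ joint φ (suc (p + p′) ∷ u) (q ∷ r)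
joint-merge φ p zero (p″ ∷ u) q r = +-identityʳ _
joint-merge φ p (suc p′) (p″ ∷ u) q r = +-identityʳ _
joint-merge φ p zero [] q r = begin
  2 * φ (suc (p + suc q) ∷ r) + dec ψ q r + 0 + (φ (p ∷ q ∷ r) + 0)
    ≡⟨ cong₂ (λ x y → 2 * x + y + 0 + (φ (p ∷ q ∷ r) + 0)) (cong (λ n → φ (n ∷ r)) n≡) (dec-fun q) ⟩
  2 * φ (suc (suc (p + 0) + q) ∷ r) + dec (φ ∘ (suc (p + 0) ∷_)) q r + 0 + (φ (p ∷ q ∷ r) + 0)
    ≡⟨ regroup (φ (suc (suc (p + 0) + q) ∷ r)) (dec (φ ∘ (suc (p + 0) ∷_)) q r) (φ (p ∷ q ∷ r)) ⟩
  2 * φ (suc (suc (p + 0) + q) ∷ r) + dec (φ ∘ (suc (p + 0) ∷_)) q r + φ (p ∷ q ∷ r)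
    ≡⟨ cong (λ n → 2 * φ (suc (suc (p + 0) + q) ∷ r) + dec (φ ∘ (suc (p + 0) ∷_)) q r + φ (n ∷ q ∷ r))
            (sym (+-identityʳ p)) ⟩
  joint φ (suc (p + 0) ∷ []) (q ∷ r) ∎
  where
  open ≡-Reasoning
  ψ = φ ∘ merge p ∘ (0 ∷_)
  n≡ : suc (p + suc q) ≡ suc (suc (p + 0) + q)
  n≡ = cong suc (trans (+-suc p q) (cong (λ n → suc (n + q)) (sym (+-identityʳ p))))
  dec-fun : ∀ q → dec ψ q r ≡ dec (φ ∘ (suc (p + 0) ∷_)) q r
  dec-fun zero    = refl
  dec-fun (suc q) = refl
  regroup : ∀ a b c → 2 * a + b + 0 + (c + 0) ≡ 2 * a + b + c
  regroup = solve-∀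
joint-merge φ p (suc p′) [] q r = begin
  2 * φ (suc (p + suc (suc p′ + q)) ∷ r) + dec (φ ∘ merge p ∘ (suc p′ ∷_)) q r + φ (suc (p + p′) ∷ q ∷ r) + 0
    ≡⟨ +-identityʳ _ ⟩
  2 * φ (suc (p + suc (suc p′ + q)) ∷ r) + dec (φ ∘ merge p ∘ (suc p′ ∷_)) q r + φ (suc (p + p′) ∷ q ∷ r)
    ≡⟨ cong₂ _+_ (cong₂ (λ x y → 2 * x + y) (cong (λ n → φ (n ∷ r)) (n≡ p p′ q)) (dec-fun q))
                 (cong (λ n → φ (n ∷ q ∷ r)) (sym (+-suc p p′))) ⟩
  joint φ (suc (p + suc p′) ∷ []) (q ∷ r) ∎
  where
  open ≡-Reasoning
  n≡ : ∀ p p′ q → suc (p + suc (suc p′ + q)) ≡ suc (suc (p + suc p′) + q)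
  n≡ = solve-∀
  dec-fun : ∀ q → dec (φ ∘ merge p ∘ (suc p′ ∷_)) q r ≡ dec (φ ∘ (suc (p + suc p′) ∷_)) q r
  dec-fun zero    = refl
  dec-fun (suc q) = refl

joint-dec : ∀ φ p p′ u v → joint (λ w → dec φ p w) (p′ ∷ u) v ≡ dec (λ w → joint φ w v) p (p′ ∷ u)
joint-dec φ zero    p′ u v = joint-0 (p′ ∷ u) v
joint-dec φ (suc p) p′ u v = refl

∂-joint-single : ∀ φ p q w →
  ∂ (λ x → joint φ (p ∷ []) (q ∷ x)) w
    ≡ 2 * ∂ (φ ∘ (suc (p + q) ∷_)) w + ∂ (λ x → dec (φ ∘ (p ∷_)) q x) w + ∂ (λ x → dec φ p (q ∷ x)) w
∂-joint-single φ p q w = begin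
  ∂ (λ x → joint φ (p ∷ []) (q ∷ x)) w
    ≡⟨ ∂-+ (λ x → 2 * f x + g x) h w ⟩
  ∂ (λ x → 2 * f x + g x) w + ∂ h w
    ≡⟨ cong (_+ ∂ h w) (∂-+ (λ x → 2 * f x) g w) ⟩
  ∂ (λ x → 2 * f x) w + ∂ g w + ∂ h w
    ≡⟨ cong (λ x → x + ∂ g w + ∂ h w) (∂-rel (scaled-additive 2) {ψ = f} w (λ _ _ _ → refl)) ⟩
  2 * ∂ f w + ∂ g w + ∂ h w ∎
  where
  open ≡-Reasoning
  f g h : List ℕ → ℕ
  f = φ ∘ (suc (p + q) ∷_)
  g x = dec (φ ∘ (p ∷_)) q x
  h x = dec φ p (q ∷ x)

-- Both sides are explicit sums of values of φ. Which values occur depends on whether p and q can be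
-- lowered and on whether v has a second part; in each of the eight cases the terms match.
joint-∂-single : ∀ φ p q r → let v = q ∷ r in
  joint (∂ φ) (p ∷ []) v
    ≡ ∂ (λ u → joint φ u v) (p ∷ []) + ∂ (joint φ (p ∷ [])) v + unit v * φ (p ∷ []) + unit (p ∷ []) * φ v
joint-∂-single φ zero zero [] = regroup (φ (0 ∷ []))
  where
  regroup : ∀ a → a + (a + 0) + 0 + 0 ≡ a + 0 + (a + 0)
  regroup = solve-∀
joint-∂-single φ zero (suc q) [] = regroup (φ (suc q ∷ [])) (dec (φ ∘ (0 ∷_)) q [])
  where
  regroup : ∀ a b → a + (a + 0) + (a + b) + 0 ≡ a + (a + 0) + b + 0 + 0 + (a + 0)
  regroup = solve-∀
joint-∂-single φ (suc p) zero [] rewrite +-identityʳ p = regroup (φ (suc p ∷ [])) (dec φ p (0 ∷ []))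
  where
  regroup : ∀ a b → a + (a + 0) + 0 + (b + a + 0) ≡ a + (a + 0) + 0 + b + 0 + (a + 0) + 0
  regroup = solve-∀
joint-∂-single φ (suc p) (suc q) [] rewrite +-suc p q =
  regroup (φ (2+ (p + q) ∷ [])) (φ (p ∷ q ∷ [])) (dec (φ ∘ (suc p ∷_)) q []) (dec φ p (suc q ∷ []))
  where
  regroup : ∀ a b c d →
    a + (a + 0) + (b + a + c) + (d + a + b) ≡ a + (a + 0) + b + d + (a + (a + 0) + c + b) + 0 + 0
  regroup = solve-∀
joint-∂-single φ zero zero (n ∷ r) rewrite ∂-joint-single φ 0 0 (n ∷ r) | ∂-0 (n ∷ r) =
  regroup (φ (0 ∷ n ∷ r)) (φ (2+ n ∷ r)) (∂ (φ ∘ (1 ∷_)) (n ∷ r))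
  where
  regroup : ∀ a b c →
    a + b + c + (a + b + c + 0) + 0 + 0 ≡ b + (b + 0) + a + 0 + (c + (c + 0) + 0 + 0) + 0 + (a + 0)
  regroup = solve-∀
joint-∂-single φ zero (suc q) (n ∷ r) rewrite ∂-joint-single φ 0 (suc q) (n ∷ r) | ∂-0 (n ∷ r) =
  regroup (φ (suc q ∷ n ∷ r)) (φ (2+ (suc (q + n)) ∷ r)) (∂ (φ ∘ (2+ q ∷_)) (n ∷ r))
          (dec (φ ∘ (0 ∷_)) q (n ∷ r)) (φ (0 ∷ suc (q + n) ∷ r)) (∂ (λ x → φ (0 ∷ q ∷ x)) (n ∷ r))
  where
  regroup : ∀ a b c d e f →
    a + b + c + (a + b + c + 0) + (a + (d + e + f)) + 0
      ≡ a + (a + 0) + d + 0 + (b + (b + 0) + e + 0) + (c + (c + 0) + f + 0) + 0 + (a + 0)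
  regroup = solve-∀
joint-∂-single φ (suc p) zero (n ∷ r)
  rewrite ∂-joint-single φ (suc p) 0 (n ∷ r) | ∂-0 (n ∷ r) | +-identityʳ p | +-suc p n =
  regroup (φ (suc p ∷ n ∷ r)) (φ (2+ (suc (p + n)) ∷ r)) (∂ (φ ∘ (2+ p ∷_)) (n ∷ r))
          (dec φ p (0 ∷ n ∷ r)) (φ (p ∷ suc n ∷ r)) (∂ (λ x → φ (p ∷ 0 ∷ x)) (n ∷ r))
  where
  regroup : ∀ a b c d e f →
    a + b + c + (a + b + c + 0) + 0 + (d + a + (e + f))
      ≡ a + (a + 0) + 0 + d + (b + (b + 0) + a + e + (c + (c + 0) + 0 + f)) + 0 + 0
  regroup = solve-∀
joint-∂-single φ (suc p) (suc q) (n ∷ r)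
  rewrite ∂-joint-single φ (suc p) (suc q) (n ∷ r) | +-suc p q
        | +-suc p (suc (q + n)) | +-suc p (q + n) | sym (+-assoc p q n) =
  regroup (φ (2+ (p + q) ∷ n ∷ r)) (φ (2+ (2+ (p + q + n)) ∷ r)) (∂ (φ ∘ (2+ (suc (p + q)) ∷_)) (n ∷ r))
          (φ (p ∷ q ∷ n ∷ r)) (dec (φ ∘ (suc p ∷_)) q (n ∷ r)) (φ (suc p ∷ suc (q + n) ∷ r))
          (∂ (λ x → φ (suc p ∷ q ∷ x)) (n ∷ r))
          (dec φ p (suc q ∷ n ∷ r)) (φ (p ∷ 2+ (q + n) ∷ r)) (∂ (λ x → φ (p ∷ suc q ∷ x)) (n ∷ r))
  where
  regroup : ∀ a b c d e f g h i j →
    a + b + c + (a + b + c + 0) + (d + a + (e + f + g)) + (h + a + (d + i + j))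
      ≡ a + (a + 0) + d + h
        + (a + (a + 0) + e + d + (b + (b + 0) + f + i) + (c + (c + 0) + g + j)) + 0 + 0
  regroup = solve-∀

-- The derivation is compatible with the coproduct up to the terms where u or v is the empty word.
joint-∂ : ∀ φ p u q r → let v = q ∷ r in
  joint (∂ φ) (p ∷ u) v
    ≡ ∂ (λ u′ → joint φ u′ v) (p ∷ u) + ∂ (joint φ (p ∷ u)) v + unit v * φ (p ∷ u) + unit (p ∷ u) * φ v
joint-∂ φ p []       q r = joint-∂-single φ p q r
joint-∂ φ p (p′ ∷ u) q r = begin
  joint (λ x → ∂ φ (p ∷ x)) (p′ ∷ u) v
    ≡⟨ joint-cong (p′ ∷ u) v (λ _ _ → refl) ⟩
  joint (λ x → dec φ p x + φ (merge p x) + ∂ (φ ∘ (p ∷_)) x) (p′ ∷ u) v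
    ≡⟨ joint-+ (λ x → dec φ p x + φ (merge p x)) (∂ (φ ∘ (p ∷_))) (p′ ∷ u) v ⟩
  joint (λ x → dec φ p x + φ (merge p x)) (p′ ∷ u) v + joint (∂ (φ ∘ (p ∷_))) (p′ ∷ u) v
    ≡⟨ cong₂ _+_ (joint-+ (dec φ p) (φ ∘ merge p) (p′ ∷ u) v) (joint-∂ (φ ∘ (p ∷_)) p′ u q r) ⟩
  joint (dec φ p) (p′ ∷ u) v + joint (φ ∘ merge p) (p′ ∷ u) v + (x + y + z + unit (p′ ∷ u) * φ (p ∷ v))
    ≡⟨ cong (λ a → a + joint (φ ∘ merge p) (p′ ∷ u) v + (x + y + z + unit (p′ ∷ u) * φ (p ∷ v)))
            (joint-dec φ p p′ u v) ⟩
  d + joint (φ ∘ merge p) (p′ ∷ u) v + (x + y + z + unit (p′ ∷ u) * φ (p ∷ v))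
    ≡⟨ regroup d (joint (φ ∘ merge p) (p′ ∷ u) v) x y z (unit (p′ ∷ u) * φ (p ∷ v)) ⟩
  d + (joint (φ ∘ merge p) (p′ ∷ u) v + unit (p′ ∷ u) * φ (p ∷ v)) + x + y + z + 0
    -- The boundary term of the inductive call is exactly the correction that merging p needs. The
    -- boundary term for `p ∷ p′ ∷ u` itself vanishes, since this list contains a d.
    ≡⟨ cong₂ (λ a b → d + a + x + y + z + b) (joint-merge φ p p′ u q r) (long p) ⟩
  d + joint φ (merge p (p′ ∷ u)) v + x + y + z + unit (p ∷ p′ ∷ u) * φ v
    ≡⟨ cong (λ a → d + joint φ (merge p (p′ ∷ u)) v + a + y + z + unit (p ∷ p′ ∷ u) * φ v)
            (∂-cong (p′ ∷ u) (λ _ _ → refl)) ⟩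
  ∂ (λ u′ → joint φ u′ v) (p ∷ p′ ∷ u) + y + z + unit (p ∷ p′ ∷ u) * φ v ∎
  where
  open ≡-Reasoning
  v = q ∷ r
  d = dec (λ w → joint φ w v) p (p′ ∷ u)
  x = ∂ (λ u′ → joint (φ ∘ (p ∷_)) u′ v) (p′ ∷ u)
  y = ∂ (joint φ (p ∷ p′ ∷ u)) v
  z = unit v * φ (p ∷ p′ ∷ u)
  long : ∀ p → 0 ≡ unit (p ∷ p′ ∷ u) * φ v
  long zero    = refl
  long (suc p) = refl
  regroup : ∀ d j x y z u → d + j + (x + y + z + u) ≡ d + (j + u) + x + y + z + 0
  regroup = solve-∀

scaled-comm-additive : ∀ k l → Additive (λ x y → x ≡ k * (y * l))
scaled-comm-additive k l = record
  { zero~ = sym (*-zeroʳ k)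
  ; plus~ = λ {a} {b} {c} {d} p q → trans (cong₂ _+_ p q) (regroup k l b d) }
  where
  regroup : ∀ k l b d → k * (b * l) + k * (d * l) ≡ k * ((b + d) * l)
  regroup = solve-∀

scaled²-additive : ∀ k l → Additive (λ x y → x ≡ k * (l * y))
scaled²-additive k l = record
  { zero~ = sym (trans (cong (k *_) (*-zeroʳ l)) (*-zeroʳ k))
  ; plus~ = λ {a} {b} {c} {d} p q → trans (cong₂ _+_ p q) (regroup k l b d) }
  where
  regroup : ∀ k l b d → k * (l * b) + k * (l * d) ≡ k * (l * (b + d))
  regroup = solve-∀

-- After `joint-∂`, the induction on the total degree evaluates the terms where ∂ acts on u or on v.
-- Their binomials add up by Pascal's rule, and the boundary terms supply what is missing when a
-- factor is the empty word.
β₀-coproduct-at : ∀ n p u q r → deg (p ∷ u) + deg (q ∷ r) < n →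
  joint β₀ (p ∷ u) (q ∷ r)
    ≡ binom (suc (deg (p ∷ u))) (suc (deg (q ∷ r))) * (β₀ (p ∷ u) * β₀ (q ∷ r))
β₀-coproduct-at (suc n) p u′ q r′ (s≤s le) = begin
  joint β₀ u v
    ≡⟨ joint-cong u v β₀-∂ ⟩
  joint (λ w → ∂ β₀ w + unit w) u v
    ≡⟨ joint-+ (∂ β₀) unit u v ⟩
  joint (∂ β₀) u v + joint unit u v
    ≡⟨ trans (cong (joint (∂ β₀) u v +_) (joint-unit u v)) (+-identityʳ _) ⟩
  joint (∂ β₀) u v
    ≡⟨ joint-∂ β₀ p u′ q r′ ⟩
  ∂ (λ u → joint β₀ u v) u + ∂ (joint β₀ u) v + unit v * β₀ u + unit u * β₀ v
    ≡⟨ cong₂ (λ x y → x + y + unit v * β₀ u + unit u * β₀ v) left right ⟩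
  binom (deg u) (suc (deg v)) * (∂ β₀ u * β₀ v) + binom (suc (deg u)) (deg v) * (β₀ u * ∂ β₀ v)
    + unit v * β₀ u + unit u * β₀ v
    ≡⟨ binom-Leibniz p u′ q r′ ⟩
  binom (suc (deg u)) (suc (deg v)) * (β₀ u * β₀ v) ∎
  where
  open ≡-Reasoning
  u = p ∷ u′
  v = q ∷ r′
  left : ∂ (λ u → joint β₀ u v) u ≡ binom (deg u) (suc (deg v)) * (∂ β₀ u * β₀ v)
  left = ∂-rel (scaled-comm-additive (binom (deg u) (suc (deg v))) (β₀ v)) u λ s t eq →
    trans (β₀-coproduct-at n s t q r′ (≤-trans (≤-reflexive (cong (_+ deg v) eq)) le))
          (cong (λ k → binom k (suc (deg v)) * (β₀ (s ∷ t) * β₀ v)) eq)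
  right : ∂ (joint β₀ u) v ≡ binom (suc (deg u)) (deg v) * (β₀ u * ∂ β₀ v)
  right = ∂-rel (scaled²-additive (binom (suc (deg u)) (deg v)) (β₀ u)) v λ s t eq →
    trans (β₀-coproduct-at n p u′ s t
             (≤-trans (≤-reflexive (trans (sym (+-suc (deg u) _)) (cong (deg u +_) eq))) le))
          (cong (λ k → binom (suc (deg u)) k * (β₀ u * β₀ (s ∷ t))) eq)

β₀-coproduct : ∀ p u q r →
  joint β₀ (p ∷ u) (q ∷ r)
    ≡ binom (suc (deg (p ∷ u))) (suc (deg (q ∷ r))) * (β₀ (p ∷ u) * β₀ (q ∷ r))
β₀-coproduct p u q r = β₀-coproduct-at _ p u q r ≤-refl

-- The product recursion

split : (List ℕ → List ℕ → ℕ) → List ℕ → ℕ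
split F []          = 0
split F (p ∷ [])    = 0
split F (p ∷ q ∷ r) = F (p ∷ []) (q ∷ r) + split (λ u v → F (p ∷ u) v) (q ∷ r)

split-rel : ∀ {_~_} → Additive _~_ → ∀ {F G} w →
  (∀ p u q r → (p ∷ u) ++ (q ∷ r) ≡ w → F (p ∷ u) (q ∷ r) ~ G (p ∷ u) (q ∷ r)) → split F w ~ split G w
split-rel add []          h = Additive.zero~ add
split-rel add (p ∷ [])    h = Additive.zero~ add
split-rel add (p ∷ q ∷ r) h =
  Additive.plus~ add (h p [] q r refl)
    (split-rel add (q ∷ r) (λ p′ u q′ r′ eq → h p (p′ ∷ u) q′ r′ (cong (p ∷_) eq)))

split-cong : ∀ {F G} w → (∀ p u q r → F (p ∷ u) (q ∷ r) ≡ G (p ∷ u) (q ∷ r)) → split F w ≡ split G w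
split-cong w h = split-rel ≡-additive w (λ p u q r _ → h p u q r)

split-+ : ∀ F G w → split (λ u v → F u v + G u v) w ≡ split F w + split G w
split-+ F G []          = refl
split-+ F G (p ∷ [])    = refl
split-+ F G (p ∷ q ∷ r) =
  trans (cong (F (p ∷ []) (q ∷ r) + G (p ∷ []) (q ∷ r) +_)
              (split-+ (λ u v → F (p ∷ u) v) (λ u v → G (p ∷ u) v) (q ∷ r)))
        (interchange₂ (F (p ∷ []) (q ∷ r)) (G (p ∷ []) (q ∷ r)) _ _)

split-0 : ∀ w → split (λ _ _ → 0) w ≡ 0
split-0 w = split-rel (scaled-additive 0) {G = λ _ _ → 0} w (λ _ _ _ _ _ → refl)

-- A cut falls inside the first list, between the two lists, or inside the second.
split-++ : ∀ F p u q r →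
  split F ((p ∷ u) ++ (q ∷ r))
    ≡ split (λ u v → F u (v ++ q ∷ r)) (p ∷ u) + (F (p ∷ u) (q ∷ r) + split (λ v w → F ((p ∷ u) ++ v) w) (q ∷ r))
split-++ F p []       q r = refl
split-++ F p (p′ ∷ u) q r =
  trans (cong (F (p ∷ []) (p′ ∷ u ++ q ∷ r) +_) (split-++ (λ u v → F (p ∷ u) v) p′ u q r))
        (sym (+-assoc (F (p ∷ []) (p′ ∷ u ++ q ∷ r)) _ _))

split-merge : ∀ F p q r → split (λ u v → F (merge p u) v) (q ∷ r) ≡ split F (suc (p + q) ∷ r)
split-merge F p q []      = refl
split-merge F p q (n ∷ r) = cong (F (suc (p + q) ∷ []) (n ∷ r) +_) (split-cong (n ∷ r) (λ _ _ _ _ → refl))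

split-dec : ∀ F p q r →
  dec (split F) p (q ∷ r) ≡ dec (λ u → F u (q ∷ r)) p [] + split (λ u v → dec (λ x → F x v) p u) (q ∷ r)
split-dec F zero    q r = sym (split-0 (q ∷ r))
split-dec F (suc p) q r = refl

-- A cut never separates two parts that have just been merged, and ∂ never merges across a cut. So a
-- step of ∂ followed by a cut is a cut followed by a step of ∂ in one piece.
∂-split : ∀ F w → ∂ (split F) w ≡ split (λ u v → ∂ (λ x → F x v) u + ∂ (F u) v) w
∂-split F []            = refl
∂-split F (zero ∷ [])   = refl
∂-split F (suc p ∷ [])  = refl
∂-split F (p ∷ q ∷ r)   = begin
  dec (split F) p w + split F (suc (p + q) ∷ r) + ∂ (λ x → split F (p ∷ x)) w
    ≡⟨ cong₂ _+_ (cong₂ _+_ (split-dec F p q r) (sym (split-merge F p q r))) (inner (∂-split (λ u v → F (p ∷ u) v) (q ∷ r))) ⟩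
  dec (λ u → F u w) p [] + a + b + (∂ (F (p ∷ [])) w + (c + d))
    ≡⟨ regroup (dec (λ u → F u w) p []) a b (∂ (F (p ∷ [])) w) c d ⟩
  dec (λ u → F u w) p [] + ∂ (F (p ∷ [])) w + (a + b + c + d)
    ≡⟨ cong (dec (λ u → F u w) p [] + ∂ (F (p ∷ [])) w +_) collect ⟩
  split (λ u v → ∂ (λ x → F x v) u + ∂ (F u) v) (p ∷ w) ∎
  where
  open ≡-Reasoning
  w = q ∷ r
  F₁ F₂ F₃ F₄ : List ℕ → List ℕ → ℕ
  F₁ u v = dec (λ x → F x v) p u
  F₂ u v = F (merge p u) v
  F₃ u v = ∂ (λ x → F (p ∷ x) v) u
  F₄ u v = ∂ (F (p ∷ u)) v
  a = split F₁ w
  b = split F₂ w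
  c = split F₃ w
  d = split F₄ w
  inner : ∂ (split (λ u v → F (p ∷ u) v)) w ≡ split (λ u v → F₃ u v + F₄ u v) w →
          ∂ (λ x → split F (p ∷ x)) w ≡ ∂ (F (p ∷ [])) w + (c + d)
  inner ih = begin
    ∂ (λ x → split F (p ∷ x)) w
      ≡⟨ ∂-cong w (λ _ _ → refl) ⟩
    ∂ (λ x → F (p ∷ []) x + split (λ u v → F (p ∷ u) v) x) w
      ≡⟨ ∂-+ (F (p ∷ [])) (split (λ u v → F (p ∷ u) v)) w ⟩
    ∂ (F (p ∷ [])) w + ∂ (split (λ u v → F (p ∷ u) v)) w
      ≡⟨ cong (∂ (F (p ∷ [])) w +_) (trans ih (split-+ F₃ F₄ w)) ⟩
    ∂ (F (p ∷ [])) w + (c + d) ∎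
  collect : a + b + c + d ≡ split (λ u v → ∂ (λ x → F x v) (p ∷ u) + ∂ (F (p ∷ u)) v) w
  collect = begin
    a + b + c + d                                       ≡⟨ cong (λ x → x + c + d) (split-+ F₁ F₂ w) ⟨
    split (λ u v → F₁ u v + F₂ u v) w + c + d           ≡⟨ cong (_+ d) (split-+ (λ u v → F₁ u v + F₂ u v) F₃ w) ⟨
    split (λ u v → F₁ u v + F₂ u v + F₃ u v) w + d    ≡⟨ split-+ (λ u v → F₁ u v + F₂ u v + F₃ u v) F₄ w ⟨
    split (λ u v → F₁ u v + F₂ u v + F₃ u v + F₄ u v) w ≡⟨ split-cong w (λ _ _ _ _ → refl) ⟩
    split (λ u v → ∂ (λ x → F x v) (p ∷ u) + ∂ (F (p ∷ u)) v) w ∎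
  regroup : ∀ x a b y c d → x + a + b + (y + (c + d)) ≡ x + y + (a + b + c + d)
  regroup = solve-∀

-- The extra one stands on the left only. Pascal's rule then leaves a boundary term just for the
-- empty word u, matching the one that lowering the head produces in `∂-decHead`.
weight : List ℕ → List ℕ → ℕ
weight u v = binom (suc (deg u)) (deg v) * (β₀ u * β₀ v)

weight-∂ : ∀ p u q r →
  ∂ (λ x → weight x (q ∷ r)) (p ∷ u) + ∂ (weight (p ∷ u)) (q ∷ r) + unit (p ∷ u) * β₀ (q ∷ r)
    ≡ weight (p ∷ u) (q ∷ r)
weight-∂ p u′ q r = trans (cong₂ (λ x y → x + y + unit u * β₀ v) left right) (binom-Leibniz-pred p u′ q r)
  where
  u = p ∷ u′
  v = q ∷ r
  left : ∂ (λ x → weight x v) u ≡ binom (deg u) (deg v) * (∂ β₀ u * β₀ v)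
  left = ∂-rel (scaled-comm-additive (binom (deg u) (deg v)) (β₀ v)) u λ s t eq →
    cong (λ k → binom k (deg v) * (β₀ (s ∷ t) * β₀ v)) eq
  right : ∂ (weight u) v ≡ binom (suc (deg u)) (pred (deg v)) * (β₀ u * ∂ β₀ v)
  right = ∂-rel (scaled²-additive (binom (suc (deg u)) (pred (deg v))) (β₀ u)) v λ s t eq →
    cong (λ k → binom (suc (deg u)) k * (β₀ u * β₀ (s ∷ t))) (cong pred eq)

split-unit : ∀ (φ : List ℕ → ℕ) p q r → split (λ u v → unit u * φ v) (suc p ∷ q ∷ r) ≡ 0
split-unit φ p q r = trans (split-cong (q ∷ r) (λ _ _ _ _ → refl)) (split-0 (q ∷ r))

-- Lowering the head almost commutes with ∂. The exception is a head 0: merged with q it becomes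
-- `suc q`, which can be lowered back to q. The split on the right has this one term.
∂-decHead : ∀ p r →
  ∂ (λ w → unit w + decHead β₀ w) (p ∷ r) ≡ decHead β₀ (p ∷ r) + split (λ u v → unit u * β₀ v) (p ∷ r)
∂-decHead zero          []      = refl
∂-decHead (suc zero)    []      = refl
∂-decHead (suc (suc p)) []      = trans (sym (+-identityʳ _)) (trans (sym (β₀-∂ (suc p) [])) (sym (+-identityʳ _)))
∂-decHead zero          (q ∷ r) = begin
  0 + β₀ (q ∷ r) + ∂ (λ w → unit (0 ∷ w) + 0) (q ∷ r)
    ≡⟨ cong (β₀ (q ∷ r) +_) (trans (∂-cong (q ∷ r) (λ _ _ → refl)) (∂-0 (q ∷ r))) ⟩
  β₀ (q ∷ r) + 0
    ≡⟨ cong₂ _+_ (+-identityʳ _) (trans (split-cong (q ∷ r) (λ _ _ _ _ → refl)) (split-0 (q ∷ r))) ⟨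
  β₀ (q ∷ r) + 0 + split (λ u v → unit (0 ∷ u) * β₀ v) (q ∷ r) ∎
  where open ≡-Reasoning
∂-decHead (suc p) (q ∷ r) = begin
  unit (p ∷ q ∷ r) + dec β₀ p (q ∷ r) + β₀ (suc p + q ∷ r) + ∂ (λ w → 0 + β₀ (p ∷ w)) (q ∷ r)
    ≡⟨ cong (λ x → x + dec β₀ p (q ∷ r) + β₀ (suc p + q ∷ r) + ∂ (λ w → β₀ (p ∷ w)) (q ∷ r)) (long p) ⟩
  ∂ β₀ (p ∷ q ∷ r)
    ≡⟨ β₀-∂-long p q r ⟨
  β₀ (p ∷ q ∷ r)
    ≡⟨ trans (cong (β₀ (p ∷ q ∷ r) +_) (split-unit β₀ p q r)) (+-identityʳ _) ⟨
  β₀ (p ∷ q ∷ r) + split (λ u v → unit u * β₀ v) (suc p ∷ q ∷ r) ∎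
  where
  open ≡-Reasoning
  long : ∀ p → unit (p ∷ q ∷ r) ≡ 0
  long zero    = refl
  long (suc p) = refl

-- The right side solves the recursion f = ∂ f + `unit` that determines `β₀`: the surplus in
-- `∂-decHead` is what the split of `weight` loses under ∂.
β₀-product-at : ∀ n p r → deg (p ∷ r) < n →
  β₀ (p ∷ r) ≡ unit (p ∷ r) + decHead β₀ (p ∷ r) + split weight (p ∷ r)
β₀-product-at (suc n) p r (s≤s le) = begin
  β₀ w
    ≡⟨ β₀-∂ p r ⟩
  ∂ β₀ w + unit w
    ≡⟨ cong (_+ unit w) (∂-rel ≡-additive w λ q s eq →
         β₀-product-at n q s (≤-trans (≤-reflexive eq) le)) ⟩
  ∂ (λ x → unit x + decHead β₀ x + split weight x) w + unit w
    ≡⟨ cong (_+ unit w) (∂-+ (λ x → unit x + decHead β₀ x) (split weight) w) ⟩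
  ∂ (λ x → unit x + decHead β₀ x) w + ∂ (split weight) w + unit w
    ≡⟨ cong₂ (λ x y → x + y + unit w) (∂-decHead p r) (∂-split weight w) ⟩
  decHead β₀ w + split U w + split (λ u v → ∂ (λ x → weight x v) u + ∂ (weight u) v) w + unit w
    ≡⟨ regroup (decHead β₀ w) (split U w) _ (unit w) ⟩
  unit w + decHead β₀ w + (split (λ u v → ∂ (λ x → weight x v) u + ∂ (weight u) v) w + split U w)
    ≡⟨ cong (unit w + decHead β₀ w +_)
         (trans (sym (split-+ (λ u v → ∂ (λ x → weight x v) u + ∂ (weight u) v) U w)) (split-cong w weight-∂)) ⟩
  unit w + decHead β₀ w + split weight w ∎
  where
  open ≡-Reasoning
  w = p ∷ r
  U : List ℕ → List ℕ → ℕ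
  U u v = unit u * β₀ v
  regroup : ∀ a b c d → a + b + c + d ≡ d + a + (c + b)
  regroup = solve-∀

β₀-product : ∀ p q r → β₀ (p ∷ q ∷ r) ≡ dec β₀ p (q ∷ r) + split weight (p ∷ q ∷ r)
β₀-product zero    q r = β₀-product-at _ zero (q ∷ r) ≤-refl
β₀-product (suc p) q r = β₀-product-at _ (suc p) (q ∷ r) ≤-refl

-- Reversal

dec-snoc : ∀ φ q r s → dec φ q (r ++ s) ≡ dec (λ x → φ (x ++ s)) q r
dec-snoc φ zero    r s = refl
dec-snoc φ (suc q) r s = refl

-- ∂ is defined from the left end; peeling it from the right end as well exhibits its symmetry under
-- reversal.
∂-snoc : ∀ φ u q p →
  ∂ φ (u ++ q ∷ p ∷ [])
    ≡ ∂ (λ x → φ (x ++ p ∷ [])) (u ++ q ∷ []) + φ (u ++ suc (q + p) ∷ []) + dec (λ x → φ (u ++ q ∷ x)) p []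
∂-snoc φ []           q p = cong (λ x → x + φ (suc (q + p) ∷ []) + dec (φ ∘ (q ∷_)) p []) (dec-snoc φ q [] (p ∷ []))
∂-snoc φ (n ∷ [])     q p =
  trans (cong₂ (λ x y → x + φ (suc (n + q) ∷ p ∷ []) + (y + φ (n ∷ suc (q + p) ∷ []) + dec (λ x → φ (n ∷ q ∷ x)) p []))
               (dec-snoc φ n (q ∷ []) (p ∷ [])) (dec-snoc (φ ∘ (n ∷_)) q [] (p ∷ [])))
        (regroup (dec (λ x → φ (x ++ p ∷ [])) n (q ∷ [])) _ (dec (λ x → φ (n ∷ x ++ p ∷ [])) q []) _ _)
  where
  regroup : ∀ a b c d e → a + b + (c + d + e) ≡ a + b + c + d + e
  regroup = solve-∀
∂-snoc φ (n ∷ n′ ∷ u) q p =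
  trans (cong₂ _+_ (cong₂ _+_ (trans (cong (dec φ n) (sym (++-assoc (n′ ∷ u) (q ∷ []) (p ∷ []))))
                                     (dec-snoc φ n (n′ ∷ u ++ q ∷ []) (p ∷ [])))
                              (cong (λ x → φ (suc (n + n′) ∷ x)) (sym (++-assoc u (q ∷ []) (p ∷ [])))))
                   (∂-snoc (φ ∘ (n ∷_)) (n′ ∷ u) q p))
        (regroup (dec (λ x → φ (x ++ p ∷ [])) n (n′ ∷ u ++ q ∷ [])) _
                 (∂ (λ x → φ (n ∷ x ++ p ∷ [])) (n′ ∷ u ++ q ∷ [])) _ _)
  where
  regroup : ∀ a b c d e → a + b + (c + d + e) ≡ a + b + c + d + e
  regroup = solve-∀

reverse-∷∷ : ∀ (p q : ℕ) r → reverse (p ∷ q ∷ r) ≡ reverse r ++ q ∷ p ∷ []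
reverse-∷∷ p q r = trans (unfold-reverse p (q ∷ r))
  (trans (cong (_++ p ∷ []) (unfold-reverse q r)) (++-assoc (reverse r) (q ∷ []) (p ∷ [])))

∂-reverse : ∀ φ w → ∂ (φ ∘ reverse) w ≡ ∂ φ (reverse w)
∂-reverse φ []           = refl
∂-reverse φ (zero ∷ [])  = refl
∂-reverse φ (suc p ∷ []) = refl
∂-reverse φ (p ∷ q ∷ r)  = begin
  dec (φ ∘ reverse) p (q ∷ r) + φ (reverse (suc (p + q) ∷ r)) + ∂ (φ ∘ reverse ∘ (p ∷_)) (q ∷ r)
    ≡⟨ cong₂ _+_ (cong₂ _+_ (lowered p) (cong φ (trans (unfold-reverse (suc (p + q)) r)
                   (cong (λ n → reverse r ++ suc n ∷ []) (+-comm p q)))))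
                   (inner (∂-reverse (λ x → φ (x ++ p ∷ [])) (q ∷ r))) ⟩
  x + y + z
    ≡⟨ regroup x y z ⟩
  z + y + x
    ≡⟨ ∂-snoc φ (reverse r) q p ⟨
  ∂ φ (reverse r ++ q ∷ p ∷ [])
    ≡⟨ cong (∂ φ) (reverse-∷∷ p q r) ⟨
  ∂ φ (reverse (p ∷ q ∷ r)) ∎
  where
  open ≡-Reasoning
  x = dec (λ x → φ (reverse r ++ q ∷ x)) p []
  y = φ (reverse r ++ suc (q + p) ∷ [])
  z = ∂ (λ x → φ (x ++ p ∷ [])) (reverse r ++ q ∷ [])
  lowered : ∀ p → dec (φ ∘ reverse) p (q ∷ r) ≡ dec (λ x → φ (reverse r ++ q ∷ x)) p []
  lowered zero    = refl
  lowered (suc p) = cong φ (reverse-∷∷ p q r)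
  inner : ∂ ((λ x → φ (x ++ p ∷ [])) ∘ reverse) (q ∷ r) ≡ ∂ (λ x → φ (x ++ p ∷ [])) (reverse (q ∷ r)) →
          ∂ (φ ∘ reverse ∘ (p ∷_)) (q ∷ r) ≡ z
  inner ih = trans (∂-cong (q ∷ r) (λ q′ s → cong φ (unfold-reverse p (q′ ∷ s))))
          (trans ih (cong (∂ (λ x → φ (x ++ p ∷ []))) (unfold-reverse q r)))
  regroup : ∀ x y z → x + y + z ≡ z + y + x
  regroup = solve-∀

β₀-∂-snoc : ∀ u q p → β₀ (u ++ q ∷ p ∷ []) ≡ ∂ β₀ (u ++ q ∷ p ∷ [])
β₀-∂-snoc []           q p = β₀-∂-long q p []
β₀-∂-snoc (n ∷ [])     q p = β₀-∂-long n q (p ∷ [])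
β₀-∂-snoc (n ∷ n′ ∷ u) q p = β₀-∂-long n n′ (u ++ q ∷ p ∷ [])

β₀-reverse-at : ∀ n w → deg w < n → β₀ (reverse w) ≡ β₀ w
β₀-reverse-at n []          _ = refl
β₀-reverse-at n (p ∷ [])    _ = refl
β₀-reverse-at (suc n) (p ∷ q ∷ r) (s≤s le) = begin
  β₀ (reverse w)                       ≡⟨ cong β₀ (reverse-∷∷ p q r) ⟩
  β₀ (reverse r ++ q ∷ p ∷ [])         ≡⟨ β₀-∂-snoc (reverse r) q p ⟩
  ∂ β₀ (reverse r ++ q ∷ p ∷ [])       ≡⟨ cong (∂ β₀) (reverse-∷∷ p q r) ⟨
  ∂ β₀ (reverse w)                     ≡⟨ ∂-reverse β₀ w ⟨
  ∂ (β₀ ∘ reverse) w                   ≡⟨ ∂-rel ≡-additive w (λ q s eq →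
                                            β₀-reverse-at n (q ∷ s) (≤-trans (≤-reflexive eq) le)) ⟩
  ∂ β₀ w                               ≡⟨ β₀-∂-long p q r ⟨
  β₀ w                                 ∎
  where
  open ≡-Reasoning
  w = p ∷ q ∷ r

β₀-reverse : ∀ w → β₀ (reverse w) ≡ β₀ w
β₀-reverse w = β₀-reverse-at _ w ≤-refl

-- Growth in an end part, and the first inequality

size-reverse : ∀ w → size (reverse w) ≡ size w
size-reverse []      = refl
size-reverse (p ∷ w) = begin
  size (reverse (p ∷ w))             ≡⟨ cong size (unfold-reverse p w) ⟩
  size (reverse w ++ p ∷ [])         ≡⟨ size-++ (reverse w) (p ∷ []) ⟩
  size (reverse w) + (2 + (p + 0))   ≡⟨ cong (_+ (2 + (p + 0))) (size-reverse w) ⟩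
  size w + (2 + (p + 0))             ≡⟨ regroup (size w) p ⟩
  2 + (p + size w)                   ∎
  where
  open ≡-Reasoning
  regroup : ∀ s p → s + (2 + (p + 0)) ≡ 2 + (p + s)
  regroup = solve-∀

deg-snoc : ∀ u m → deg (u ++ m ∷ []) ≡ size u + m
deg-snoc u m = trans (deg-++ u m []) (cong (size u +_) (+-identityʳ m))

-- In degree one less, induction bounds the terms of ∂ with the constant d + 1, where d is the
-- degree of `n ∷ w`. The constant d + 2 is reached because lowering `suc n` gives `β₀ (n ∷ w)`
-- itself: one of its `suc n` copies is set aside and only n of them need induction.
β₀-growth-at : ∀ k n w → deg (n ∷ w) < k → suc n * β₀ (suc n ∷ w) ≤ suc (suc (deg (n ∷ w))) * β₀ (n ∷ w)
β₀-growth-at k n [] _ rewrite β₀-single (suc n) | +-identityʳ n = *-monoˡ-≤ 1 (n≤1+n (suc n))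
β₀-growth-at (suc k) n (q ∷ r) (s≤s le) = begin
  suc n * β₀ (suc n ∷ w)
    ≡⟨ cong (suc n *_) (β₀-∂-long (suc n) q r) ⟩
  suc n * (β₀ (n ∷ w) + β₀ (2+ (n + q) ∷ r) + ∂ (β₀ ∘ (suc n ∷_)) w)
    ≡⟨ regroup₁ (suc n) (β₀ (n ∷ w)) _ _ ⟩
  suc n * β₀ (n ∷ w) + suc n * β₀ (2+ (n + q) ∷ r) + suc n * ∂ (β₀ ∘ (suc n ∷_)) w
    ≤⟨ +-mono-≤ (+-mono-≤ (lowered n le) merged) inner ⟩
  (suc d * dec β₀ n w + β₀ (n ∷ w)) + suc d * β₀ (suc (n + q) ∷ r) + suc d * ∂ (β₀ ∘ (n ∷_)) w
    ≡⟨ regroup₂ (suc d) (dec β₀ n w) (β₀ (n ∷ w)) _ _ ⟩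
  β₀ (n ∷ w) + suc d * ∂ β₀ (n ∷ w)
    ≡⟨ cong (λ x → β₀ (n ∷ w) + suc d * x) (β₀-∂-long n q r) ⟨
  suc (suc d) * β₀ (n ∷ w) ∎
  where
  open ≤-Reasoning
  w = q ∷ r
  d = deg (n ∷ w)
  regroup₁ : ∀ s a b c → s * (a + b + c) ≡ s * a + s * b + s * c
  regroup₁ = solve-∀
  regroup₂ : ∀ s a e b c → (s * a + e) + s * b + s * c ≡ e + s * (a + b + c)
  regroup₂ = solve-∀
  lowered : ∀ n → deg (n ∷ w) ≤ k → suc n * β₀ (n ∷ w) ≤ suc (deg (n ∷ w)) * dec β₀ n w + β₀ (n ∷ w)
  lowered zero    _  = ≤-trans (≤-reflexive (+-identityʳ _)) (m≤n+m (β₀ (0 ∷ w)) (suc (deg (0 ∷ w)) * 0))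
  lowered (suc n) le = ≤-trans (≤-reflexive (+-comm (β₀ (suc n ∷ w)) _)) (+-monoˡ-≤ _ (β₀-growth-at k n w le))
  merged : suc n * β₀ (2+ (n + q) ∷ r) ≤ suc d * β₀ (suc (n + q) ∷ r)
  merged = begin
    suc n * β₀ (2+ (n + q) ∷ r)
      ≤⟨ *-monoˡ-≤ _ (s≤s (m≤n⇒m≤1+n (m≤m+n n q))) ⟩
    2+ (n + q) * β₀ (2+ (n + q) ∷ r)
      ≤⟨ β₀-growth-at k (suc (n + q)) r (≤-trans (≤-reflexive (deg-merge n q r)) le) ⟩
    suc (suc (deg (suc (n + q) ∷ r))) * β₀ (suc (n + q) ∷ r)
      ≡⟨ cong (λ x → suc x * β₀ (suc (n + q) ∷ r)) (deg-merge n q r) ⟩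
    suc d * β₀ (suc (n + q) ∷ r) ∎
  inner : suc n * ∂ (β₀ ∘ (suc n ∷_)) w ≤ suc d * ∂ (β₀ ∘ (n ∷_)) w
  inner = ∂-rel (scaled-≤-additive (suc n) (suc d)) w λ s t eq →
    let d≡ : suc (deg (n ∷ s ∷ t)) ≡ d
        d≡ = trans (sym (+-suc n _)) (cong (λ x → n + suc (suc x)) eq)
    in ≤-trans (β₀-growth-at k n (s ∷ t) (≤-trans (≤-reflexive d≡) le))
               (≤-reflexive (cong (λ x → suc x * β₀ (n ∷ s ∷ t)) d≡))

β₀-snoc : ∀ u n → β₀ (u ++ n ∷ []) ≡ β₀ (n ∷ reverse u)
β₀-snoc u n = trans (sym (β₀-reverse (u ++ n ∷ []))) (cong β₀ (reverse-++ u (n ∷ [])))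

β₀-growth : ∀ u n → suc n * β₀ (u ++ suc n ∷ []) ≤ suc (suc (size u + n)) * β₀ (u ++ n ∷ [])
β₀-growth u n = subst₂ _≤_
  (cong (suc n *_) (sym (β₀-snoc u (suc n))))
  (cong₂ (λ d x → suc (suc d) * x) (trans (cong (n +_) (size-reverse u)) (+-comm n _)) (sym (β₀-snoc u n)))
  (β₀-growth-at _ n (reverse u) ≤-refl)

-- The growth bound iterated d times; the factorials are the cleared denominators.
β₀-ratio : ∀ u d m → β₀ (u ++ d + m ∷ []) * ((d + m) ! * (suc (size u + m)) !)
                   ≤ β₀ (u ++ m ∷ []) * (m ! * (suc (size u + (d + m))) !)
β₀-ratio u zero    m = ≤-refl
β₀-ratio u (suc d) m = begin
  β₀ (u ++ suc n ∷ []) * ((suc n * n !) * f)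
    ≡⟨ regroup₁ (β₀ (u ++ suc n ∷ [])) (suc n) (n !) f ⟩
  suc n * β₀ (u ++ suc n ∷ []) * (n ! * f)
    ≤⟨ *-monoˡ-≤ (n ! * f) (β₀-growth u n) ⟩
  g * β₀ (u ++ n ∷ []) * (n ! * f)
    ≡⟨ *-assoc g (β₀ (u ++ n ∷ [])) _ ⟩
  g * (β₀ (u ++ n ∷ []) * (n ! * f))
    ≤⟨ *-monoʳ-≤ g (β₀-ratio u d m) ⟩
  g * (β₀ (u ++ m ∷ []) * (m ! * (suc (size u + n)) !))
    ≡⟨ regroup₂ g (β₀ (u ++ m ∷ [])) (m !) _ ⟩
  β₀ (u ++ m ∷ []) * (m ! * (g * (suc (size u + n)) !))
    ≡⟨ cong (λ k → β₀ (u ++ m ∷ []) * (m ! * (suc k !))) (sym (+-suc (size u) n)) ⟩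
  β₀ (u ++ m ∷ []) * (m ! * (suc (size u + suc n)) !) ∎
  where
  open ≤-Reasoning
  n = d + m
  f = (suc (size u + m)) !
  g = suc (suc (size u + n))
  regroup₁ : ∀ x s a f → x * ((s * a) * f) ≡ s * x * (a * f)
  regroup₁ = solve-∀
  regroup₂ : ∀ g x a b → g * (x * (a * b)) ≡ x * (a * (g * b))
  regroup₂ = solve-∀

-- The two binomials belong to the same row, so their quotient is a quotient of factorials. It is
-- exactly the bound of `β₀-ratio`, with no slack in the constants.
β₀-end-weight : ∀ u m n → m ≤ n →
  binom (suc (size u + n)) m * β₀ (u ++ n ∷ []) ≤ binom (suc (size u + m)) n * β₀ (u ++ m ∷ [])
β₀-end-weight u m n m≤n = *-cancelʳ-≤ _ _ (fₙ * m ! * (fₘ * n !)) (begin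
  bₙ * xₙ * (fₙ * m ! * (fₘ * n !))    ≡⟨ regroup bₙ xₙ fₙ (m !) (fₘ * n !) ⟩
  (bₙ * (fₙ * m !)) * (xₙ * (fₘ * n !)) ≡⟨ cong₂ _*_ total (cong (xₙ *_) (*-comm fₘ (n !))) ⟩
  (bₘ * (fₘ * n !)) * (xₙ * (n ! * fₘ)) ≤⟨ *-monoʳ-≤ (bₘ * (fₘ * n !)) ratio ⟩
  (bₘ * (fₘ * n !)) * (xₘ * (m ! * fₙ)) ≡⟨ regroup′ bₘ xₘ (fₘ * n !) (m !) fₙ ⟩
  bₘ * xₘ * (fₙ * m ! * (fₘ * n !))    ∎)
  where
  open ≤-Reasoning
  fₙ = (suc (size u + n)) !
  fₘ = (suc (size u + m)) !
  bₙ = binom (suc (size u + n)) m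
  bₘ = binom (suc (size u + m)) n
  xₙ = β₀ (u ++ n ∷ [])
  xₘ = β₀ (u ++ m ∷ [])
  instance _ = m*n≢0 (fₙ * m !) (fₘ * n !) {{suc (size u + n) !* m !≢0}} {{suc (size u + m) !* n !≢0}}
  ratio : xₙ * (n ! * fₘ) ≤ xₘ * (m ! * fₙ)
  ratio = subst (λ k → β₀ (u ++ k ∷ []) * (k ! * fₘ) ≤ xₘ * (m ! * (suc (size u + k)) !))
                (m∸n+n≡m m≤n) (β₀-ratio u (n ∸ m) m)
  exchange : ∀ s m n → suc (s + n) + m ≡ suc (s + m) + n
  exchange = solve-∀
  total : bₙ * (fₙ * m !) ≡ bₘ * (fₘ * n !)
  total = trans (binom-! (suc (size u + n)) m)
         (trans (cong _! (exchange (size u) m n)) (sym (binom-! (suc (size u + m)) n)))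
  regroup : ∀ b x f a c → b * x * (f * a * c) ≡ (b * (f * a)) * (x * c)
  regroup = solve-∀
  regroup′ : ∀ b x c a f → (b * c) * (x * (a * f)) ≡ b * x * (f * a * c)
  regroup′ = solve-∀

-- The terms of the product recursion at `u ++ x`, grouped by whether x survives whole behind a
-- shortened prefix, or the cut lies at the end of u or later.
front back : List ℕ → List ℕ → ℕ
front u x = decHead (λ y → β₀ (y ++ x)) u + split (λ v w → weight v (w ++ x)) u
back u x = weight u x + split (λ v w → weight (u ++ v) w) x

β₀-front-back : ∀ p u q r → β₀ ((p ∷ u) ++ q ∷ r) ≡ front (p ∷ u) (q ∷ r) + back (p ∷ u) (q ∷ r)
β₀-front-back p u q r = trans (product u) (trans (cong₂ _+_ (lowered p) (split-++ weight p u q r))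
  (sym (+-assoc (dec (λ y → β₀ (y ++ q ∷ r)) p u) _ _)))
  where
  product : ∀ u → β₀ ((p ∷ u) ++ q ∷ r) ≡ dec β₀ p (u ++ q ∷ r) + split weight ((p ∷ u) ++ q ∷ r)
  product []       = β₀-product p q r
  product (p′ ∷ u) = β₀-product p p′ (u ++ q ∷ r)
  lowered : ∀ p → dec β₀ p (u ++ q ∷ r) ≡ dec (λ y → β₀ (y ++ q ∷ r)) p u
  lowered zero    = refl
  lowered (suc p) = refl

-- In these terms x is unchanged and only the prefix gets smaller. Equal degrees of x and y make the
-- binomials agree.
front-mono : ∀ p u q r q′ r′ → let x = q ∷ r; y = q′ ∷ r′ in deg y ≡ deg x →
  (∀ v → deg (v ++ x) < deg ((p ∷ u) ++ x) → β₀ (v ++ y) ≤ β₀ (v ++ x)) →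
  front (p ∷ u) y ≤ front (p ∷ u) x
front-mono p u q r q′ r′ deg≡ h = +-mono-≤ (lowered p h) (split-rel ≤-additive (p ∷ u) term)
  where
  x y : List ℕ
  x = q ∷ r
  y = q′ ∷ r′
  lowered : ∀ p → (∀ v → deg (v ++ x) < deg ((p ∷ u) ++ x) → β₀ (v ++ y) ≤ β₀ (v ++ x)) →
            dec (λ z → β₀ (z ++ y)) p u ≤ dec (λ z → β₀ (z ++ x)) p u
  lowered zero    h = z≤n
  lowered (suc p) h = h (p ∷ u) ≤-refl
  term : ∀ a v b w → (a ∷ v) ++ (b ∷ w) ≡ p ∷ u → weight (a ∷ v) ((b ∷ w) ++ y) ≤ weight (a ∷ v) ((b ∷ w) ++ x)
  term a v b w eq = *-mono-≤
    (≤-reflexive (cong (binom (suc (deg (a ∷ v)))) deg-eq))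
    (*-monoʳ-≤ (β₀ (a ∷ v)) (h (b ∷ w) smaller))
    where
    deg-eq : deg ((b ∷ w) ++ y) ≡ deg ((b ∷ w) ++ x)
    deg-eq = trans (deg-++ (b ∷ w) q′ r′) (trans (cong (size (b ∷ w) +_) deg≡) (sym (deg-++ (b ∷ w) q r)))
    smaller : deg ((b ∷ w) ++ x) < deg ((p ∷ u) ++ x)
    smaller = begin-strict
      deg ((b ∷ w) ++ x)                       ≡⟨ deg-++ (b ∷ w) q r ⟩
      size (b ∷ w) + deg x                     <⟨ +-monoˡ-< (deg x) (m<n+m (size (b ∷ w)) {size (a ∷ v)} (s≤s z≤n)) ⟩
      size (a ∷ v) + size (b ∷ w) + deg x      ≡⟨ cong (_+ deg x) (trans (sym (size-++ (a ∷ v) (b ∷ w))) (cong size eq)) ⟩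
      size (p ∷ u) + deg x                     ≡⟨ deg-++ (p ∷ u) q r ⟨
      deg ((p ∷ u) ++ x)                       ∎
      where open ≤-Reasoning

β₀-swap : ∀ u m n v → β₀ (reverse v ++ n ∷ m ∷ reverse u) ≡ β₀ (u ++ m ∷ n ∷ v)
β₀-swap u m n v = trans (cong β₀ (sym eq)) (β₀-reverse (u ++ m ∷ n ∷ v))
  where
  open ≡-Reasoning
  eq : reverse (u ++ m ∷ n ∷ v) ≡ reverse v ++ n ∷ m ∷ reverse u
  eq = begin
    reverse (u ++ m ∷ n ∷ v)                     ≡⟨ reverse-++ u (m ∷ n ∷ v) ⟩
    reverse (m ∷ n ∷ v) ++ reverse u             ≡⟨ cong (_++ reverse u) (reverse-∷∷ m n v) ⟩
    (reverse v ++ n ∷ m ∷ []) ++ reverse u       ≡⟨ ++-assoc (reverse v) (n ∷ m ∷ []) (reverse u) ⟩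
    reverse v ++ n ∷ m ∷ reverse u               ∎

deg-pair-comm : ∀ m n → deg (m ∷ n ∷ []) ≡ deg (n ∷ m ∷ [])
deg-pair-comm = regroup
  where
  regroup : ∀ m n → m + (2 + (n + 0)) ≡ n + (2 + (m + 0))
  regroup = solve-∀

β₀-end-order-at : ∀ k u m n → m < n → deg (u ++ m ∷ n ∷ []) < k → β₀ (u ++ n ∷ m ∷ []) ≤ β₀ (u ++ m ∷ n ∷ [])
β₀-end-order-at k []      m n m<n le = ≤-reflexive (β₀-swap [] m n [])
β₀-end-order-at (suc k) (p ∷ u′) m n m<n (s≤s le) = begin
  β₀ (u ++ n ∷ m ∷ [])                         ≡⟨ β₀-front-back p u′ n (m ∷ []) ⟩
  front u (n ∷ m ∷ []) + back u (n ∷ m ∷ [])   ≤⟨ +-mono-≤ fronts backs ⟩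
  front u (m ∷ n ∷ []) + back u (m ∷ n ∷ [])   ≡⟨ β₀-front-back p u′ m (n ∷ []) ⟨
  β₀ (u ++ m ∷ n ∷ [])                         ∎
  where
  open ≤-Reasoning
  u = p ∷ u′
  fronts : front u (n ∷ m ∷ []) ≤ front u (m ∷ n ∷ [])
  fronts = front-mono p u′ m (n ∷ []) n (m ∷ []) (deg-pair-comm n m)
    (λ v lt → β₀-end-order-at k v m n m<n (<-≤-trans lt le))
  end : ∀ m n → weight (u ++ m ∷ []) (n ∷ []) ≡ binom (suc (size u + m)) n * β₀ (u ++ m ∷ [])
  end m n = cong₂ _*_ (cong₂ (λ a b → binom (suc a) b) (deg-snoc u m) (+-identityʳ n))
    (trans (cong (β₀ (u ++ m ∷ []) *_) (β₀-single n)) (*-identityʳ _))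
  backs : back u (n ∷ m ∷ []) ≤ back u (m ∷ n ∷ [])
  -- A cut before the pair gives equal terms, since a list of two parts may be reversed. The cut
  -- inside the pair is the exceptional term.
  backs = +-mono-≤
    (≤-reflexive (cong₂ (λ d x → binom (suc (deg u)) d * (β₀ u * x)) (deg-pair-comm n m) (β₀-swap [] m n [])))
    (+-monoˡ-≤ 0 (subst₂ _≤_ (sym (end n m)) (sym (end m n)) (β₀-end-weight u m n (<⇒≤ m<n))))

β₀-end-order : ∀ u m n → m < n → β₀ (u ++ n ∷ m ∷ []) ≤ β₀ (u ++ m ∷ n ∷ [])
β₀-end-order u m n m<n = β₀-end-order-at _ u m n m<n ≤-refl

-- The second inequality

-- For pairs of equal sum, ∣ m₁ - n₁ ∣ < ∣ m₂ - n₂ ∣ says that one of m₂, n₂ lies below both m₁ and n₁.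
Closer : ℕ → ℕ → ℕ → ℕ → Set
Closer m₁ n₁ m₂ n₂ = (m₂ < m₁ × m₂ < n₁) ⊎ (n₂ < m₁ × n₂ < n₁)

-- The induction hypothesis as a type. It ranges over all pairs and all surroundings, because
-- lowering changes the pair and cutting changes the surroundings.
StrictBelow : ℕ → Set
StrictBelow d = ∀ {m₁ n₁ m₂ n₂} → m₁ + n₁ ≡ m₂ + n₂ → Closer m₁ n₁ m₂ n₂ →
  ∀ u v → deg (u ++ m₁ ∷ n₁ ∷ v) < d → β₀ (u ++ m₂ ∷ n₂ ∷ v) < β₀ (u ++ m₁ ∷ n₁ ∷ v)

β₀-pos-++ : ∀ u p r → 0 < β₀ (u ++ p ∷ r)
β₀-pos-++ []      p r = β₀-pos p r
β₀-pos-++ (n ∷ u) p r = β₀-pos n (u ++ p ∷ r)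

joint-snoc : ∀ φ u m n v → joint φ (u ++ m ∷ []) (n ∷ v)
  ≡ 2 * φ (u ++ suc (m + n) ∷ v) + dec (λ x → φ (u ++ m ∷ x)) n v + dec (λ x → φ (u ++ x)) m (n ∷ v)
joint-snoc φ []           m n v = refl
joint-snoc φ (p ∷ [])     m n v = refl
joint-snoc φ (p ∷ p′ ∷ u) m n v = joint-snoc (φ ∘ (p ∷_)) (p′ ∷ u) m n v

β₀-coproduct-snoc : ∀ u m n v → joint β₀ (u ++ m ∷ []) (n ∷ v)
  ≡ binom (suc (size u + m)) (suc (deg (n ∷ v))) * (β₀ (u ++ m ∷ []) * β₀ (n ∷ v))
β₀-coproduct-snoc u m n v = trans (coproduct u)
  (cong (λ a → binom (suc a) (suc (deg (n ∷ v))) * (β₀ (u ++ m ∷ []) * β₀ (n ∷ v))) (deg-snoc u m))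
  where
  coproduct : ∀ u → joint β₀ (u ++ m ∷ []) (n ∷ v)
    ≡ binom (suc (deg (u ++ m ∷ []))) (suc (deg (n ∷ v))) * (β₀ (u ++ m ∷ []) * β₀ (n ∷ v))
  coproduct []      = β₀-coproduct m [] n v
  coproduct (p ∷ u) = β₀-coproduct p (u ++ m ∷ []) n v

-- The coproduct identity expresses the product of β₀ (u , m) and β₀ (n , v) through values in
-- degree one less than (u , m , n , v), so the induction hypothesis compares these products.
joint-strict : ∀ {m₁ n₁ m₂ n₂} → m₁ + n₁ ≡ m₂ + n₂ → Closer m₁ n₁ m₂ n₂ →
  ∀ u v → StrictBelow (deg (u ++ m₁ ∷ n₁ ∷ v)) →
  joint β₀ (u ++ m₂ ∷ []) (n₂ ∷ v) < joint β₀ (u ++ m₁ ∷ []) (n₁ ∷ v)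
joint-strict {m₁} {n₁} {m₂} {n₂} sum≡ closer u v ih = subst₂ _<_ (sym (joint-snoc β₀ u m₂ n₂ v)) (sym (joint-snoc β₀ u m₁ n₁ v))
  (subst (λ s → 2 * β₀ (u ++ suc (m₂ + n₂) ∷ v) + right m₂ n₂ + left m₂ n₂ < 2 * β₀ (u ++ suc s ∷ v) + right m₁ n₁ + left m₁ n₁)
         (sym sum≡)
         (subst₂ _<_ (sym (+-assoc c _ _)) (sym (+-assoc c _ _)) (+-monoʳ-< c (lowered sum≡ closer ih))))
  where
  c = 2 * β₀ (u ++ suc (m₂ + n₂) ∷ v)
  right left : ℕ → ℕ → ℕ
  right m n = dec (λ x → β₀ (u ++ m ∷ x)) n v
  left m n = dec (λ x → β₀ (u ++ x)) m (n ∷ v)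
  deg-left : ∀ m n → deg (u ++ m ∷ n ∷ v) < deg (u ++ suc m ∷ n ∷ v)
  deg-left m n = subst₂ _<_ (sym (deg-++ u m (n ∷ v))) (sym (deg-++ u (suc m) (n ∷ v))) (+-monoʳ-< (size u) ≤-refl)
  deg-right : ∀ m n → deg (u ++ m ∷ n ∷ v) < deg (u ++ m ∷ suc n ∷ v)
  deg-right m n = subst₂ _<_ (sym (deg-++ u m (n ∷ v))) (sym (deg-++ u m (suc n ∷ v)))
    (+-monoʳ-< (size u) (+-monoʳ-< m ≤-refl))
  -- Lowering on one side is compared with lowering on the other. Comparing the same sides could
  -- lead to a pair and its mirror image, between which nothing is known in the middle of a list;
  -- crosswise, the boundary case is an equality of lists. If the least entry is 0 it cannot be
  -- lowered, and positivity gives strictness.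
  lowered : ∀ {m₁ n₁ m₂ n₂} → m₁ + n₁ ≡ m₂ + n₂ → Closer m₁ n₁ m₂ n₂ → StrictBelow (deg (u ++ m₁ ∷ n₁ ∷ v)) →
            right m₂ n₂ + left m₂ n₂ < right m₁ n₁ + left m₁ n₁
  lowered {suc a₁} {suc b₁} {m₂} {zero} sum≡ (inj₁ (s≤s m₂≤a₁ , s≤s m₂≤b₁)) ih =
    ⊥-elim (<-irrefl (sym (trans sum≡ (+-identityʳ m₂))) (s≤s (≤-trans m₂≤a₁ (m≤m+n a₁ (suc b₁)))))
  lowered {suc a₁} {suc b₁} {m₂} {suc b₂} sum≡ (inj₁ (s≤s m₂≤a₁ , s≤s m₂≤b₁)) ih =
    subst (_< right (suc a₁) (suc b₁) + left (suc a₁) (suc b₁)) (+-comm (left m₂ (suc b₂)) _)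
      (+-mono-<-≤ (strict m₂ sum≡ m₂≤a₁ m₂≤b₁) (weak (m≤n⇒m<n∨m≡n m₂≤a₁)))
    where
    sum≡′ : a₁ + suc b₁ ≡ m₂ + b₂
    sum≡′ = suc-injective (trans sum≡ (+-suc m₂ b₂))
    weak : m₂ < a₁ ⊎ m₂ ≡ a₁ → β₀ (u ++ m₂ ∷ b₂ ∷ v) ≤ β₀ (u ++ a₁ ∷ suc b₁ ∷ v)
    weak (inj₁ m₂<a₁) = <⇒≤ (ih sum≡′ (inj₁ (m₂<a₁ , s≤s m₂≤b₁)) u v (deg-left a₁ (suc b₁)))
    weak (inj₂ refl)  = ≤-reflexive (cong (λ n → β₀ (u ++ a₁ ∷ n ∷ v)) (sym (+-cancelˡ-≡ a₁ _ _ sum≡′)))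
    strict : ∀ m₂ → suc a₁ + suc b₁ ≡ m₂ + suc b₂ → m₂ ≤ a₁ → m₂ ≤ b₁ → left m₂ (suc b₂) < right (suc a₁) (suc b₁)
    strict zero     _    _     _     = β₀-pos-++ u (suc a₁) (b₁ ∷ v)
    strict (suc a₂) sum≡ a₂<a₁ a₂<b₁ =
      ih (trans (sym (+-suc a₁ b₁)) (suc-injective sum≡)) (inj₁ (m≤n⇒m≤1+n a₂<a₁ , a₂<b₁)) u v (deg-right (suc a₁) b₁)
  lowered {suc a₁} {suc b₁} {zero} {n₂} sum≡ (inj₂ (s≤s n₂≤a₁ , s≤s n₂≤b₁)) ih =
    ⊥-elim (<-irrefl (sym sum≡) (s≤s (≤-trans n₂≤b₁ (≤-trans (n≤1+n b₁) (m≤n+m (suc b₁) a₁)))))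
  lowered {suc a₁} {suc b₁} {suc a₂} {n₂} sum≡ (inj₂ (s≤s n₂≤a₁ , s≤s n₂≤b₁)) ih =
    subst (right (suc a₂) n₂ + left (suc a₂) n₂ <_) (+-comm (left (suc a₁) (suc b₁)) _)
      (+-mono-<-≤ (strict n₂ sum≡ n₂≤a₁ n₂≤b₁) (weak (m≤n⇒m<n∨m≡n n₂≤b₁)))
    where
    sum≡′ : suc a₁ + b₁ ≡ a₂ + n₂
    sum≡′ = trans (sym (+-suc a₁ b₁)) (suc-injective sum≡)
    weak : n₂ < b₁ ⊎ n₂ ≡ b₁ → β₀ (u ++ a₂ ∷ n₂ ∷ v) ≤ β₀ (u ++ suc a₁ ∷ b₁ ∷ v)
    weak (inj₁ n₂<b₁) = <⇒≤ (ih sum≡′ (inj₂ (s≤s n₂≤a₁ , n₂<b₁)) u v (deg-right (suc a₁) b₁))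
    weak (inj₂ refl)  = ≤-reflexive (cong (λ m → β₀ (u ++ m ∷ b₁ ∷ v)) (sym (+-cancelʳ-≡ b₁ _ _ sum≡′)))
    strict : ∀ n₂ → suc a₁ + suc b₁ ≡ suc a₂ + n₂ → n₂ ≤ a₁ → n₂ ≤ b₁ → right (suc a₂) n₂ < left (suc a₁) (suc b₁)
    strict zero     _    _     _     = β₀-pos-++ u a₁ (suc b₁ ∷ v)
    strict (suc b₂) sum≡ b₂<a₁ b₂<b₁ =
      ih (trans (suc-injective sum≡) (+-suc a₂ b₂)) (inj₂ (b₂<a₁ , m≤n⇒m≤1+n b₂<b₁)) u v (deg-left a₁ (suc b₁))

split-head-mono : ∀ {F G} m n v →
  (∀ x q y → x ++ q ∷ y ≡ v → F (m ∷ x) (q ∷ y) ≤ G (n ∷ x) (q ∷ y)) → split F (m ∷ v) ≤ split G (n ∷ v)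
split-head-mono m n []      h = z≤n
split-head-mono m n (q ∷ r) h =
  +-mono-≤ (h [] q r refl) (split-rel ≤-additive (q ∷ r) (λ p x q y eq → h (p ∷ x) q y eq))

deg-pair : ∀ u m n v → deg (u ++ m ∷ n ∷ v) ≡ size u + (m + n) + (2 + size v)
deg-pair u m n v = trans (deg-++ u m (n ∷ v)) (regroup (size u) m n (size v))
  where
  regroup : ∀ s m n t → s + (m + (2 + (n + t))) ≡ s + (m + n) + (2 + t)
  regroup = solve-∀

deg-pair-sum : ∀ {m₁ n₁ m₂ n₂} → m₁ + n₁ ≡ m₂ + n₂ → ∀ u v → deg (u ++ m₂ ∷ n₂ ∷ v) ≡ deg (u ++ m₁ ∷ n₁ ∷ v)
deg-pair-sum {m₁} {n₁} {m₂} {n₂} sum≡ u v =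
  trans (deg-pair u m₂ n₂ v) (trans (cong (λ s → size u + s + (2 + size v)) (sym sum≡)) (sym (deg-pair u m₁ n₁ v)))

deg-pair-mono : ∀ u m n v u′ v′ → size u + size v < size u′ + size v′ →
  deg (u ++ m ∷ n ∷ v) < deg (u′ ++ m ∷ n ∷ v′)
deg-pair-mono u m n v u′ v′ lt = subst₂ _<_
  (sym (trans (deg-pair u m n v) (regroup (size u) (m + n) (size v))))
  (sym (trans (deg-pair u′ m n v′) (regroup (size u′) (m + n) (size v′))))
  (+-monoˡ-< (m + n + 2) lt)
  where
  regroup : ∀ s p t → s + p + (2 + t) ≡ s + t + (p + 2)
  regroup = solve-∀

module _ {m₁ n₁ m₂ n₂} (sum≡ : m₁ + n₁ ≡ m₂ + n₂) (closer : Closer m₁ n₁ m₂ n₂) where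

  fronts-≤ : ∀ p u v → StrictBelow (deg ((p ∷ u) ++ m₁ ∷ n₁ ∷ v)) →
    front (p ∷ u) (m₂ ∷ n₂ ∷ v) ≤ front (p ∷ u) (m₁ ∷ n₁ ∷ v)
  fronts-≤ p u v ih = front-mono p u m₁ (n₁ ∷ v) m₂ (n₂ ∷ v) (deg-pair-sum sum≡ [] v)
    (λ w lt → <⇒≤ (ih sum≡ closer w v lt))

  weight-after-≤ : ∀ p u v → StrictBelow (deg ((p ∷ u) ++ m₁ ∷ n₁ ∷ v)) →
    split (λ x y → weight ((p ∷ u) ++ m₂ ∷ x) y) (n₂ ∷ v) ≤ split (λ x y → weight ((p ∷ u) ++ m₁ ∷ x) y) (n₁ ∷ v)
  weight-after-≤ p u v ih = split-head-mono n₂ n₁ v λ x q y eq →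
    *-mono-≤
      (≤-reflexive (cong (λ d → binom (suc d) (deg (q ∷ y))) (deg-pair-sum sum≡ (p ∷ u) x)))
      (*-monoˡ-≤ (β₀ (q ∷ y)) (<⇒≤ (ih sum≡ closer (p ∷ u) x
        (deg-pair-mono (p ∷ u) m₁ n₁ x (p ∷ u) v (+-monoʳ-< (size (p ∷ u)) (shorter x q y eq))))))
    where
    shorter : ∀ x q y → x ++ q ∷ y ≡ v → size x < size v
    shorter x q y eq = begin-strict
      size x                     <⟨ m<m+n (size x) {size (q ∷ y)} (s≤s z≤n) ⟩
      size x + size (q ∷ y)      ≡⟨ size-++ x (q ∷ y) ⟨
      size (x ++ q ∷ y)          ≡⟨ cong size eq ⟩
      size v                     ∎
      where open ≤-Reasoning

-- For a fixed sum m + n the factor on the left is constant, so weights compare like `suc b` times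
-- `joint`, where b grows with n.
weight-absorb : ∀ u m n v → let a = suc (size u + m); b = deg (n ∷ v) in
  suc (a + b) * weight (u ++ m ∷ []) (n ∷ v) ≡ suc b * joint β₀ (u ++ m ∷ []) (n ∷ v)
weight-absorb u m n v = begin
  suc (a + b) * (binom (suc (deg (u ++ m ∷ []))) b * x)   ≡⟨ cong (λ d → suc (a + b) * (binom (suc d) b * x)) (deg-snoc u m) ⟩
  suc (a + b) * (binom a b * x)                           ≡⟨ *-assoc (suc (a + b)) (binom a b) x ⟨
  suc (a + b) * binom a b * x                             ≡⟨ cong (_* x) (binom-absorbʳ a b) ⟨
  suc b * binom a (suc b) * x                             ≡⟨ *-assoc (suc b) (binom a (suc b)) x ⟩
  suc b * (binom a (suc b) * x)                           ≡⟨ cong (suc b *_) (β₀-coproduct-snoc u m n v) ⟨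
  suc b * joint β₀ (u ++ m ∷ []) (n ∷ v)                  ∎
  where
  open ≡-Reasoning
  a = suc (size u + m)
  b = deg (n ∷ v)
  x = β₀ (u ++ m ∷ []) * β₀ (n ∷ v)

weight-total : ∀ {m₁ n₁ m₂ n₂} → m₁ + n₁ ≡ m₂ + n₂ → ∀ s t →
  suc (suc (s + m₂) + (n₂ + t)) ≡ suc (suc (s + m₁) + (n₁ + t))
weight-total {m₁} {n₁} {m₂} {n₂} sum≡ s t =
  trans (regroup s m₂ n₂ t) (trans (cong (λ k → suc (suc (s + k + t))) (sym sum≡)) (sym (regroup s m₁ n₁ t)))
  where
  regroup : ∀ s m n t → suc (suc (s + m) + (n + t)) ≡ suc (suc (s + (m + n) + t))
  regroup = solve-∀

strict-right : ∀ {m₁ n₁ m₂ n₂} → m₁ + n₁ ≡ m₂ + n₂ → n₂ < m₁ → n₂ < n₁ →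
  ∀ p u v → StrictBelow (deg ((p ∷ u) ++ m₁ ∷ n₁ ∷ v)) →
  β₀ ((p ∷ u) ++ m₂ ∷ n₂ ∷ v) < β₀ ((p ∷ u) ++ m₁ ∷ n₁ ∷ v)
strict-right {m₁} {n₁} {m₂} {n₂} sum≡ n₂<m₁ n₂<n₁ p u′ v ih = begin-strict
  β₀ (u ++ m₂ ∷ n₂ ∷ v)                            ≡⟨ β₀-front-back p u′ m₂ (n₂ ∷ v) ⟩
  front u (m₂ ∷ n₂ ∷ v) + back u (m₂ ∷ n₂ ∷ v)     <⟨ +-mono-≤-< (fronts-≤ sum≡ closer p u′ v ih) backs ⟩
  front u (m₁ ∷ n₁ ∷ v) + back u (m₁ ∷ n₁ ∷ v)     ≡⟨ β₀-front-back p u′ m₁ (n₁ ∷ v) ⟨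
  β₀ (u ++ m₁ ∷ n₁ ∷ v)                            ∎
  where
  open ≤-Reasoning
  u = p ∷ u′
  closer : Closer m₁ n₁ m₂ n₂
  closer = inj₂ (n₂<m₁ , n₂<n₁)
  before : weight u (m₂ ∷ n₂ ∷ v) ≤ weight u (m₁ ∷ n₁ ∷ v)
  -- Cutting off all of u leaves the pair at the front of its list; the induction hypothesis covers
  -- the empty prefix too.
  before = *-mono-≤ (≤-reflexive (cong (binom (suc (deg u))) (deg-pair-sum {m₁} {n₁} {m₂} {n₂} sum≡ [] v)))
    (*-monoʳ-≤ (β₀ u) (<⇒≤ (ih sum≡ closer [] v (deg-pair-mono [] m₁ n₁ v u v (m<n+m (size v) (s≤s z≤n))))))
  middle : weight (u ++ m₂ ∷ []) (n₂ ∷ v) < weight (u ++ m₁ ∷ []) (n₁ ∷ v)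
  middle = *-cancelˡ-< (suc (suc (size u + m₁) + deg (n₁ ∷ v))) _ _ (begin-strict
    suc (suc (size u + m₁) + deg (n₁ ∷ v)) * weight (u ++ m₂ ∷ []) (n₂ ∷ v)
      ≡⟨ cong (_* weight (u ++ m₂ ∷ []) (n₂ ∷ v)) (weight-total sum≡ (size u) (size v)) ⟨
    suc (suc (size u + m₂) + deg (n₂ ∷ v)) * weight (u ++ m₂ ∷ []) (n₂ ∷ v)
      ≡⟨ weight-absorb u m₂ n₂ v ⟩
    suc (deg (n₂ ∷ v)) * joint β₀ (u ++ m₂ ∷ []) (n₂ ∷ v)
      <⟨ *-monoʳ-< (suc (deg (n₂ ∷ v))) (joint-strict sum≡ closer u v ih) ⟩
    suc (deg (n₂ ∷ v)) * joint β₀ (u ++ m₁ ∷ []) (n₁ ∷ v)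
      -- Here the order of the second entries decides: the absorbed factor increases with n.
      ≤⟨ *-monoˡ-≤ _ (s≤s (+-monoˡ-≤ (size v) (<⇒≤ n₂<n₁))) ⟩
    suc (deg (n₁ ∷ v)) * joint β₀ (u ++ m₁ ∷ []) (n₁ ∷ v)
      ≡⟨ weight-absorb u m₁ n₁ v ⟨
    suc (suc (size u + m₁) + deg (n₁ ∷ v)) * weight (u ++ m₁ ∷ []) (n₁ ∷ v) ∎)
  backs : back u (m₂ ∷ n₂ ∷ v) < back u (m₁ ∷ n₁ ∷ v)
  backs = +-mono-≤-< before (+-mono-<-≤ middle (weight-after-≤ sum≡ closer p u′ v ih))

dec≤joint : ∀ φ p u m r → φ ((p ∷ u) ++ m ∷ r) ≤ joint φ (p ∷ u) (suc m ∷ r)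
dec≤joint φ p []       m r = ≤-trans (m≤n+m _ (2 * φ (suc (p + suc m) ∷ r))) (m≤m+n _ _)
dec≤joint φ p (p′ ∷ u) m r = dec≤joint (φ ∘ (p ∷_)) p′ u m r

-- The list is a single term of the coproduct identity for u and c^(m+1), whose other terms are
-- non-negative.
β₀-snoc-≤ : ∀ p u m → β₀ ((p ∷ u) ++ m ∷ []) ≤ binom (suc (deg (p ∷ u))) (suc (suc m)) * β₀ (p ∷ u)
β₀-snoc-≤ p u m = begin
  β₀ ((p ∷ u) ++ m ∷ [])
    ≤⟨ dec≤joint β₀ p u m [] ⟩
  joint β₀ (p ∷ u) (suc m ∷ [])
    ≡⟨ β₀-coproduct p u (suc m) [] ⟩
  binom (suc (deg (p ∷ u))) (suc (suc m + 0)) * (β₀ (p ∷ u) * β₀ (suc m ∷ []))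
    ≡⟨ cong₂ (λ n x → binom (suc (deg (p ∷ u))) (suc n) * x) (+-identityʳ (suc m))
         (trans (cong (β₀ (p ∷ u) *_) (β₀-single (suc m))) (*-identityʳ _)) ⟩
  binom (suc (deg (p ∷ u))) (suc (suc m)) * β₀ (p ∷ u) ∎
  where open ≤-Reasoning

-- For two parts the product recursion is Pascal's rule; the added 1 replaces the lowered term that
-- is absent when the first part is 0.
β₀-pair : ∀ m n → suc (β₀ (m ∷ n ∷ [])) ≡ binom (suc m) (suc n)
β₀-pair m n = trans (cong suc (trans (β₀-product m n []) (cong (dec β₀ m (n ∷ []) +_) (trans (+-identityʳ _) weight≡))))
                    (lowered m)
  where
  weight≡ : weight (m ∷ []) (n ∷ []) ≡ binom (suc m) n
  weight≡ = trans (cong₂ (λ a b → binom (suc a) b * (β₀ (m ∷ []) * β₀ (n ∷ []))) (+-identityʳ m) (+-identityʳ n))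
           (trans (cong₂ (λ x y → binom (suc m) n * (x * y)) (β₀-single m) (β₀-single n)) (*-identityʳ _))
  lowered : ∀ m → suc (dec β₀ m (n ∷ []) + binom (suc m) n) ≡ binom (suc m) (suc n)
  lowered zero    = refl
  lowered (suc m) = cong (_+ binom (suc (suc m)) n) (β₀-pair m n)

-- The case in which the least entry stands on the left and the pair ends the list. The absorbed
-- factor now works against the inequality, and reversal would leave no prefix. The cuts before and
-- inside the pair have to be estimated together.
module _ {m₁ n₁ m₂ n₂} (sum≡ : m₁ + n₁ ≡ m₂ + n₂) (m₂<m₁ : m₂ < m₁) (m₂<n₁ : m₂ < n₁)
         (p : ℕ) (u′ : List ℕ) (ih : StrictBelow (deg ((p ∷ u′) ++ m₁ ∷ n₁ ∷ []))) where
  private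
    u = p ∷ u′
    k = deg u
    s = m₂ + n₂
    e = m₁ ∸ m₂
    d = suc (suc (size u + m₂) + n₂)
    Q = binom (suc k) (suc (suc (suc s)))
    A = β₀ u
    g = binom (suc (suc m₂)) (suc n₂)
    X = binom (suc k) (suc (suc s))
    T W Pair : ℕ → ℕ → ℕ
    T m n = joint β₀ (u ++ m ∷ []) (n ∷ [])
    W m n = weight (u ++ m ∷ []) (n ∷ [])
    Pair m n = binom (suc m) (suc n)

    m₁≡ : m₂ + e ≡ m₁
    m₁≡ = m+[n∸m]≡n (<⇒≤ m₂<m₁)

    n₂≡ : n₁ + e ≡ n₂
    n₂≡ = +-cancelˡ-≡ m₂ _ _ (begin
      m₂ + (n₁ + e)   ≡⟨ regroup m₂ n₁ e ⟩
      m₂ + e + n₁     ≡⟨ cong (_+ n₁) m₁≡ ⟩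
      m₁ + n₁         ≡⟨ sum≡ ⟩
      m₂ + n₂         ∎)
      where
      open ≡-Reasoning
      regroup : ∀ a b c → a + (b + c) ≡ a + c + b
      regroup = solve-∀

    dW : ∀ m n → m + n ≡ s → d * W m n ≡ suc n * T m n
    dW m n eq = begin
      d * W m n
        ≡⟨ cong (_* W m n) total ⟩
      suc (suc (size u + m) + (n + 0)) * W m n
        ≡⟨ weight-absorb u m n [] ⟩
      suc (n + 0) * T m n
        ≡⟨ cong (λ x → suc x * T m n) (+-identityʳ n) ⟩
      suc n * T m n ∎
      where
      open ≡-Reasoning
      total : d ≡ suc (suc (size u + m) + (n + 0))
      total = trans (cong (λ x → suc (suc (size u + m₂) + x)) (sym (+-identityʳ n₂)))
                    (weight-total {m} {n} {m₂} {n₂} eq (size u) 0)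

    dX : d * X ≡ suc (suc (suc s)) * Q
    dX = begin
      d * X                                         ≡⟨ cong (_* X) (regroup p (size u′) m₂ n₂) ⟩
      suc (suc k + suc (suc s)) * X                 ≡⟨ binom-absorbʳ (suc k) (suc (suc s)) ⟨
      suc (suc (suc s)) * Q                         ∎
      where
      open ≡-Reasoning
      regroup : ∀ p t m n → suc (suc (suc (suc (p + t)) + m) + n) ≡ suc (suc (p + t) + suc (suc (m + n)))
      regroup = solve-∀

    sC : ∀ m n → m + n ≡ s → suc (suc (suc s)) * Pair m n ≡ suc (suc m) * binom (suc (suc m)) (suc n)
    sC m n eq = trans (cong (λ x → suc (suc x) * Pair m n) (trans (cong suc (sym eq)) (sym (+-suc m n))))
                      (sym (binom-absorbˡ (suc m) (suc n)))

    -- Both factors carry a binomial, one from the coproduct identity and one from `β₀-snoc-≤`. The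
    -- trinomial identity regroups them so that `Q` depends on the pair only through its sum.
    T₂≤ : T m₂ n₂ ≤ Q * A * g
    T₂≤ = begin
      T m₂ n₂
        ≡⟨ β₀-coproduct-snoc u m₂ n₂ [] ⟩
      binom (suc (size u + m₂)) (suc (n₂ + 0)) * (β₀ (u ++ m₂ ∷ []) * β₀ (n₂ ∷ []))
        ≡⟨ cong₂ _*_ (cong₂ binom (shift k m₂) (cong suc (+-identityʳ n₂)))
                     (trans (cong (β₀ (u ++ m₂ ∷ []) *_) (β₀-single n₂)) (*-identityʳ _)) ⟩
      B * β₀ (u ++ m₂ ∷ [])
        ≤⟨ *-monoʳ-≤ B (β₀-snoc-≤ p u′ m₂) ⟩
      B * (binom (suc k) (suc (suc m₂)) * A)
        ≡⟨ *-assoc B _ A ⟨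
      B * binom (suc k) (suc (suc m₂)) * A
        ≡⟨ cong (_* A) (binom-trinomial (suc k) (suc (suc m₂)) (suc n₂)) ⟩
      binom (suc k) (suc (suc m₂) + suc n₂) * g * A
        ≡⟨ cong (λ x → binom (suc k) (suc (suc x)) * g * A) (+-suc m₂ n₂) ⟩
      Q * g * A
        ≡⟨ regroup Q g A ⟩
      Q * A * g ∎
      where
      open ≤-Reasoning
      B = binom (suc k + suc (suc m₂)) (suc n₂)
      shift : ∀ k m → suc (suc (suc k) + m) ≡ suc k + suc (suc m)
      shift = solve-∀
      regroup : ∀ q g a → q * g * a ≡ q * a * g
      regroup = solve-∀

    -- Multiplying by `d` clears all denominators. The number `e` is both m₁ - m₂ and n₂ - n₁: the
    -- loss `e * T m₂ n₂` from the second entries is at most `e * (Q * A * g)`, which is exactly the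
    -- gain in raising the factor `suc (suc m₂)` to `suc (suc m₁)`. Unimodality then replaces `g` by
    -- its counterpart for the better pair.
    ends : X * (A * Pair m₂ n₂) + W m₂ n₂ < X * (A * Pair m₁ n₁) + W m₁ n₁
    ends = *-cancelˡ-< d _ _ (begin-strict
      d * (X * (A * Pair m₂ n₂) + W m₂ n₂)
        ≡⟨ expand m₂ n₂ refl ⟩
      Q * A * (suc (suc m₂) * g) + suc n₂ * T m₂ n₂
        ≡⟨ cong (λ x → Q * A * (suc (suc m₂) * g) + suc x * T m₂ n₂) (sym n₂≡) ⟩
      Q * A * (suc (suc m₂) * g) + suc (n₁ + e) * T m₂ n₂
        ≡⟨ regroup₁ (Q * A) (suc (suc m₂)) g n₁ e (T m₂ n₂) ⟩
      Q * A * (suc (suc m₂) * g) + e * T m₂ n₂ + suc n₁ * T m₂ n₂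
        <⟨ +-mono-≤-< (+-monoʳ-≤ (Q * A * (suc (suc m₂) * g)) (*-monoʳ-≤ e T₂≤))
                      (*-monoʳ-< (suc n₁) (joint-strict sum≡ (inj₁ (m₂<m₁ , m₂<n₁)) u [] ih)) ⟩
      Q * A * (suc (suc m₂) * g) + e * (Q * A * g) + suc n₁ * T m₁ n₁
        ≡⟨ regroup₂ (Q * A) m₂ e g (suc n₁ * T m₁ n₁) ⟩
      Q * A * (suc (suc (m₂ + e)) * g) + suc n₁ * T m₁ n₁
        ≡⟨ cong (λ x → Q * A * (suc (suc x) * g) + suc n₁ * T m₁ n₁) m₁≡ ⟩
      Q * A * (suc (suc m₁) * g) + suc n₁ * T m₁ n₁
        ≤⟨ +-monoˡ-≤ (suc n₁ * T m₁ n₁) (*-monoʳ-≤ (Q * A) (*-monoʳ-≤ (suc (suc m₁)) unimodal)) ⟩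
      Q * A * (suc (suc m₁) * binom (suc (suc m₁)) (suc n₁)) + suc n₁ * T m₁ n₁
        ≡⟨ expand m₁ n₁ sum≡ ⟨
      d * (X * (A * Pair m₁ n₁) + W m₁ n₁) ∎)
      where
      open ≤-Reasoning
      unimodal : g ≤ binom (suc (suc m₁)) (suc n₁)
      unimodal = binom-unimodal
        (cong (2 +_) (trans (+-suc m₂ n₂) (trans (cong suc (sym sum≡)) (sym (+-suc m₁ n₁)))))
        (s≤s (s≤s (<⇒≤ m₂<m₁))) (s≤s m₂<n₁)
      expand : ∀ m n → m + n ≡ s →
        d * (X * (A * Pair m n) + W m n) ≡ Q * A * (suc (suc m) * binom (suc (suc m)) (suc n)) + suc n * T m n
      expand m n eq =
        trans (regroup d X A (Pair m n) (W m n))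
       (trans (cong₂ (λ x y → x * (A * Pair m n) + y) dX (dW m n eq))
       (trans (cong (_+ suc n * T m n) (regroup′ (suc (suc (suc s))) Q A (Pair m n)))
              (cong (λ x → Q * A * x + suc n * T m n) (sC m n eq))))
        where
        regroup : ∀ d x a c w → d * (x * (a * c) + w) ≡ d * x * (a * c) + d * w
        regroup = solve-∀
        regroup′ : ∀ t q a c → t * q * (a * c) ≡ q * a * (t * c)
        regroup′ = solve-∀
      regroup₁ : ∀ q a g n e t → q * (a * g) + suc (n + e) * t ≡ q * (a * g) + e * t + suc n * t
      regroup₁ = solve-∀
      regroup₂ : ∀ q m e g r → q * (suc (suc m) * g) + e * (q * g) + r ≡ q * (suc (suc (m + e)) * g) + r
      regroup₂ = solve-∀

    -- Adding `X * A`, which is the same for both pairs, turns the value at the pair into a pure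
    -- binomial by `β₀-pair`.
    back-end : ∀ m n → m + n ≡ s → back u (m ∷ n ∷ []) + X * A ≡ X * (A * Pair m n) + W m n
    back-end m n eq = begin
      binom (suc k) (deg (m ∷ n ∷ [])) * (A * β₀ (m ∷ n ∷ [])) + (W m n + 0) + X * A
        ≡⟨ cong (λ x → binom (suc k) x * (A * β₀ (m ∷ n ∷ [])) + (W m n + 0) + X * A)
                (trans (regroup₁ m n) (cong (2 +_) eq)) ⟩
      X * (A * β₀ (m ∷ n ∷ [])) + (W m n + 0) + X * A
        ≡⟨ regroup₂ X A (β₀ (m ∷ n ∷ [])) (W m n) ⟩
      X * (A * suc (β₀ (m ∷ n ∷ []))) + W m n
        ≡⟨ cong (λ x → X * (A * x) + W m n) (β₀-pair m n) ⟩
      X * (A * Pair m n) + W m n ∎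
      where
      open ≡-Reasoning
      regroup₁ : ∀ m n → m + (2 + (n + 0)) ≡ 2 + (m + n)
      regroup₁ = solve-∀
      regroup₂ : ∀ x a b w → x * (a * b) + (w + 0) + x * a ≡ x * (a * suc b) + w
      regroup₂ = solve-∀

  strict-left-end : β₀ ((p ∷ u′) ++ m₂ ∷ n₂ ∷ []) < β₀ ((p ∷ u′) ++ m₁ ∷ n₁ ∷ [])
  strict-left-end = begin-strict
    β₀ (u ++ m₂ ∷ n₂ ∷ [])                             ≡⟨ β₀-front-back p u′ m₂ (n₂ ∷ []) ⟩
    front u (m₂ ∷ n₂ ∷ []) + back u (m₂ ∷ n₂ ∷ [])     <⟨ +-mono-≤-< (fronts-≤ sum≡ (inj₁ (m₂<m₁ , m₂<n₁)) p u′ [] ih)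
                                                            (+-cancelʳ-< (X * A) _ _ (subst₂ _<_ (sym (back-end m₂ n₂ refl))
                                                              (sym (back-end m₁ n₁ sum≡)) ends)) ⟩
    front u (m₁ ∷ n₁ ∷ []) + back u (m₁ ∷ n₁ ∷ [])     ≡⟨ β₀-front-back p u′ m₁ (n₁ ∷ []) ⟨
    β₀ (u ++ m₁ ∷ n₁ ∷ [])                             ∎
    where open ≤-Reasoning

-- For single parts the coproduct sum is the binomial `binom (suc m) (suc n)`, hence the value at
-- the pair plus one.
strict-both-ends : ∀ {m₁ n₁ m₂ n₂} → m₁ + n₁ ≡ m₂ + n₂ → Closer m₁ n₁ m₂ n₂ →
  StrictBelow (deg (m₁ ∷ n₁ ∷ [])) → β₀ (m₂ ∷ n₂ ∷ []) < β₀ (m₁ ∷ n₁ ∷ [])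
strict-both-ends {m₁} {n₁} {m₂} {n₂} sum≡ closer ih = s<s⁻¹ (subst₂ _<_ (joint≡ m₂ n₂) (joint≡ m₁ n₁) (joint-strict sum≡ closer [] [] ih))
  where
  joint≡ : ∀ m n → joint β₀ (m ∷ []) (n ∷ []) ≡ suc (β₀ (m ∷ n ∷ []))
  joint≡ m n = trans (β₀-coproduct-snoc [] m n [])
    (trans (cong₂ (λ b x → binom (suc m) (suc b) * x) (+-identityʳ n) (cong₂ _*_ (β₀-single m) (β₀-single n)))
    (trans (*-identityʳ _) (sym (β₀-pair m n))))

deg-swap : ∀ u m n v → deg (reverse v ++ n ∷ m ∷ reverse u) ≡ deg (u ++ m ∷ n ∷ v)
deg-swap u m n v = begin
  deg (reverse v ++ n ∷ m ∷ reverse u)                       ≡⟨ deg-pair (reverse v) n m (reverse u) ⟩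
  size (reverse v) + (n + m) + (2 + size (reverse u))        ≡⟨ cong₂ (λ a b → a + (n + m) + (2 + b)) (size-reverse v) (size-reverse u) ⟩
  size v + (n + m) + (2 + size u)                            ≡⟨ regroup (size u) m n (size v) ⟩
  size u + (m + n) + (2 + size v)                            ≡⟨ deg-pair u m n v ⟨
  deg (u ++ m ∷ n ∷ v)                                       ∎
  where
  open ≡-Reasoning
  regroup : ∀ s m n t → t + (n + m) + (2 + s) ≡ s + (m + n) + (2 + t)
  regroup = solve-∀

reverse-nonempty : ∀ (q : ℕ) v → ∃ λ p → ∃ λ w → reverse (q ∷ v) ≡ p ∷ w
reverse-nonempty q v with reverse (q ∷ v) in eq
... | p ∷ w = p , w , refl
... | []    with trans (sym (reverse-involutive (q ∷ v))) (cong reverse eq)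
...   | ()

strict-below : ∀ d → StrictBelow d
strict-below (suc d) {m₁} {n₁} {m₂} {n₂} sum≡ closer u v (s≤s le) = go closer u v
  (λ sum≡′ closer′ u′ v′ lt → strict-below d sum≡′ closer′ u′ v′ (<-≤-trans lt le))
  where
  sum≡ʳ : n₁ + m₁ ≡ n₂ + m₂
  sum≡ʳ = trans (+-comm n₁ m₁) (trans sum≡ (+-comm m₂ n₂))
  go : Closer m₁ n₁ m₂ n₂ → ∀ u v → StrictBelow (deg (u ++ m₁ ∷ n₁ ∷ v)) →
       β₀ (u ++ m₂ ∷ n₂ ∷ v) < β₀ (u ++ m₁ ∷ n₁ ∷ v)
  go closer [] [] ih = strict-both-ends sum≡ closer ih
  go (inj₂ (n₂<m₁ , n₂<n₁)) (p ∷ u) v  ih = strict-right sum≡ n₂<m₁ n₂<n₁ p u v ih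
  go (inj₁ (m₂<m₁ , m₂<n₁)) (p ∷ u) [] ih = strict-left-end sum≡ m₂<m₁ m₂<n₁ p u ih
  -- Reversal moves the least entry to the right and turns the non-empty tail into the prefix that
  -- `strict-right` needs.
  go (inj₁ (m₂<m₁ , m₂<n₁)) u (q ∷ v)  ih with reverse-nonempty q v
  ... | p , w , eq = subst₂ _<_ (β₀-swap u m₂ n₂ (q ∷ v)) (β₀-swap u m₁ n₁ (q ∷ v))
    (subst (λ x → β₀ (x ++ n₂ ∷ m₂ ∷ reverse u) < β₀ (x ++ n₁ ∷ m₁ ∷ reverse u)) (sym eq)
      (strict-right sum≡ʳ m₂<n₁ m₂<m₁ p w (reverse u)
        (subst StrictBelow (trans (sym (deg-swap u m₁ n₁ (q ∷ v))) (cong (λ x → deg (x ++ n₁ ∷ m₁ ∷ reverse u)) eq)) ih)))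
  -- With no prefix, reversal puts the pair at the end with its least entry on the left.
  go (inj₂ (n₂<m₁ , n₂<n₁)) [] (q ∷ v) ih with reverse-nonempty q v
  ... | p , w , eq = subst₂ _<_ (β₀-swap [] m₂ n₂ (q ∷ v)) (β₀-swap [] m₁ n₁ (q ∷ v))
    (subst (λ x → β₀ (x ++ n₂ ∷ m₂ ∷ []) < β₀ (x ++ n₁ ∷ m₁ ∷ [])) (sym eq)
      (strict-left-end sum≡ʳ n₂<n₁ n₂<m₁ p w
        (subst StrictBelow (trans (sym (deg-swap [] m₁ n₁ (q ∷ v))) (cong (λ x → deg (x ++ n₁ ∷ m₁ ∷ [])) eq)) ih)))

β₀-strict : ∀ {m₁ n₁ m₂ n₂} → m₁ + n₁ ≡ m₂ + n₂ → Closer m₁ n₁ m₂ n₂ →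
  ∀ u v → β₀ (u ++ m₂ ∷ n₂ ∷ v) < β₀ (u ++ m₁ ∷ n₁ ∷ v)
β₀-strict sum≡ closer u v = strict-below _ sum≡ closer u v ≤-refl

-- If m₁ ≤ m₂, equal sums force n₂ ≤ n₁, so the first pair would be at least as far apart.
below-of-∣-∣ : ∀ m₁ n₁ m₂ n₂ → m₁ + n₁ ≡ m₂ + n₂ → m₂ ≤ n₂ → ∣ m₁ - n₁ ∣ < ∣ m₂ - n₂ ∣ → m₂ < m₁
below-of-∣-∣ m₁ n₁ m₂ n₂ sum≡ m₂≤n₂ lt = ≰⇒> λ m₁≤m₂ → <-irrefl refl (begin-strict
  ∣ m₁ - n₁ ∣   <⟨ lt ⟩
  ∣ m₂ - n₂ ∣   ≡⟨ m≤n⇒∣m-n∣≡n∸m m₂≤n₂ ⟩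
  n₂ ∸ m₂       ≤⟨ ∸-mono (+-cancelˡ-≤ m₂ _ _ (≤-trans (≤-reflexive (sym sum≡)) (+-monoˡ-≤ n₁ m₁≤m₂))) m₁≤m₂ ⟩
  n₁ ∸ m₁       ≤⟨ m∸n≤∣m-n∣ n₁ m₁ ⟩
  ∣ n₁ - m₁ ∣   ≡⟨ ∣-∣-comm n₁ m₁ ⟩
  ∣ m₁ - n₁ ∣   ∎)
  where open ≤-Reasoning

closer : ∀ m₁ n₁ m₂ n₂ → m₁ + n₁ ≡ m₂ + n₂ → ∣ m₁ - n₁ ∣ < ∣ m₂ - n₂ ∣ → Closer m₁ n₁ m₂ n₂
closer m₁ n₁ m₂ n₂ sum≡ lt with ≤-total m₂ n₂
... | inj₁ m₂≤n₂ = inj₁ ( below-of-∣-∣ m₁ n₁ m₂ n₂ sum≡ m₂≤n₂ lt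
                        , below-of-∣-∣ n₁ m₁ m₂ n₂ (trans (+-comm n₁ m₁) sum≡) m₂≤n₂ (subst (_< _) (∣-∣-comm m₁ n₁) lt))
... | inj₂ n₂≤m₂ = inj₂ ( below-of-∣-∣ m₁ n₁ n₂ m₂ (trans sum≡ (+-comm m₂ n₂)) n₂≤m₂ lt′
                        , below-of-∣-∣ n₁ m₁ n₂ m₂ (trans (+-comm n₁ m₁) (trans sum≡ (+-comm m₂ n₂))) n₂≤m₂
                                       (subst (_< _) (∣-∣-comm m₁ n₁) lt′))
  where
  lt′ : ∣ m₁ - n₁ ∣ < ∣ n₂ - m₂ ∣
  lt′ = subst (∣ m₁ - n₁ ∣ <_) (∣-∣-comm m₂ n₂) lt

-- Filtered sums

module FilteredSum {A : Set} {_⊕_ : A → A → A} {0# : A} (isMonoid : IsMonoid _≡_ _⊕_ 0#) where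
  open IsMonoid isMonoid using (assoc; identityˡ)

  sumIf : {B : Set} → (B → Bool) → (B → A) → List B → A
  sumIf p f xs = foldr _⊕_ 0# (map f (filterᵇ p xs))

  sumIf-++ : {B : Set} (p : B → Bool) (f : B → A) (xs ys : List B) →
             sumIf p f (xs ++ ys) ≡ sumIf p f xs ⊕ sumIf p f ys
  sumIf-++ p f []       ys = sym (identityˡ _)
  sumIf-++ p f (x ∷ xs) ys with p x
  ... | true  = trans (cong (f x ⊕_) (sumIf-++ p f xs ys)) (sym (assoc (f x) _ _))
  ... | false = sumIf-++ p f xs ys

  sumIf-map : {B C : Set} (p : C → Bool) (f : C → A) (g : B → C) (xs : List B) →
              sumIf p f (map g xs) ≡ sumIf (p ∘ g) (f ∘ g) xs
  sumIf-map p f g []       = refl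
  sumIf-map p f g (x ∷ xs) with p (g x)
  ... | true  = cong (f (g x) ⊕_) (sumIf-map p f g xs)
  ... | false = sumIf-map p f g xs

  sumIf-cong : {B : Set} {p q : B → Bool} {f g : B → A} (xs : List B) →
               (∀ x → p x ≡ q x) → (∀ x → p x ≡ true → f x ≡ g x) → sumIf p f xs ≡ sumIf q g xs
  sumIf-cong []       p≗q f≗g = refl
  sumIf-cong {p = p} {q} (x ∷ xs) p≗q f≗g with p x | q x | p≗q x | f≗g x
  ... | true  | .true  | refl | fx≡gx = cong₂ _⊕_ (fx≡gx refl) (sumIf-cong xs p≗q f≗g)
  ... | false | .false | refl | _     = sumIf-cong xs p≗q f≗g

  sumIf-none : {B : Set} {p : B → Bool} {f : B → A} (xs : List B) → (∀ x → p x ≡ false) → sumIf p f xs ≡ 0#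
  sumIf-none []       none = refl
  sumIf-none {p = p} (x ∷ xs) none with p x | none x
  ... | .false | refl = sumIf-none xs none

open FilteredSum +-0-isMonoid using () renaming
  (sumIf to sumIfℕ; sumIf-++ to sumIfℕ-++; sumIf-map to sumIfℕ-map; sumIf-none to sumIfℕ-none)
open FilteredSum ℤ.+-0-isMonoid using () renaming
  (sumIf to sumIfℤ; sumIf-++ to sumIfℤ-++; sumIf-map to sumIfℤ-map; sumIf-cong to sumIfℤ-cong; sumIf-none to sumIfℤ-none)

-- The flag f-vector of the Boolean lattice

zeros : List Bool → ℕ
zeros []          = 0
zeros (true ∷ x)  = zeros x
zeros (false ∷ x) = suc (zeros x)

card+zeros : ∀ x → card x + zeros x ≡ length x
card+zeros []          = refl
card+zeros (true ∷ x)  = cong suc (card+zeros x)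
card+zeros (false ∷ x) = trans (+-suc (card x) (zeros x)) (cong suc (card+zeros x))

-- The filtered sum of `chainCount` in recursive form: letter by letter, an element of x is kept and
-- a missing one may be added.
sumAbove : (List Bool → ℕ) → List Bool → ℕ → ℕ
sumAbove φ []          zero    = φ []
sumAbove φ []          (suc k) = 0
sumAbove φ (true ∷ x)  zero    = 0
sumAbove φ (true ∷ x)  (suc k) = sumAbove (φ ∘ (true ∷_)) x k
sumAbove φ (false ∷ x) zero    = sumAbove (φ ∘ (false ∷_)) x 0
sumAbove φ (false ∷ x) (suc k) = sumAbove (φ ∘ (false ∷_)) x (suc k) + sumAbove (φ ∘ (true ∷_)) x k

sumIf≡sumAbove : ∀ φ x k →
  sumIfℕ (λ y → subsetᵇ x y ∧ (card y ≡ᵇ k)) φ (allWords (length x)) ≡ sumAbove φ x k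
sumIf≡sumAbove φ [] zero    = +-identityʳ _
sumIf≡sumAbove φ [] (suc k) = refl
sumIf≡sumAbove φ (b ∷ x) k =
  trans (sumIfℕ-++ P φ (map (false ∷_) ws) (map (true ∷_) ws))
  (trans (cong₂ _+_ (sumIfℕ-map P φ (false ∷_) ws) (sumIfℕ-map P φ (true ∷_) ws)) (go b k))
  where
  ws = allWords (length x)
  P : List Bool → Bool
  P y = subsetᵇ (b ∷ x) y ∧ (card y ≡ᵇ k)
  go : ∀ b k →
    sumIfℕ (λ y → subsetᵇ (b ∷ x) (false ∷ y) ∧ (card y ≡ᵇ k)) (φ ∘ (false ∷_)) ws
    + sumIfℕ (λ y → subsetᵇ (b ∷ x) (true ∷ y) ∧ (suc (card y) ≡ᵇ k)) (φ ∘ (true ∷_)) ws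
    ≡ sumAbove φ (b ∷ x) k
  go true zero = cong₂ _+_ (sumIfℕ-none ws (λ _ → refl)) (sumIfℕ-none ws (λ y → ∧-zeroʳ (subsetᵇ x y)))
  go true (suc k) = cong₂ _+_ (sumIfℕ-none {f = φ ∘ (false ∷_)} ws (λ _ → refl)) (sumIf≡sumAbove (φ ∘ (true ∷_)) x k)
  go false zero = trans (cong₂ _+_ (sumIf≡sumAbove (φ ∘ (false ∷_)) x 0) (sumIfℕ-none ws (λ y → ∧-zeroʳ (subsetᵇ x y))))
                        (+-identityʳ _)
  go false (suc k) = cong₂ _+_ (sumIf≡sumAbove (φ ∘ (false ∷_)) x (suc k)) (sumIf≡sumAbove (φ ∘ (true ∷_)) x k)

sumAbove-low : ∀ φ x k → k < card x → sumAbove φ x k ≡ 0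
sumAbove-low φ (true ∷ x)  zero    lt       = refl
sumAbove-low φ (true ∷ x)  (suc k) (s≤s lt) = sumAbove-low (φ ∘ (true ∷_)) x k lt
sumAbove-low φ (false ∷ x) zero    lt       = sumAbove-low (φ ∘ (false ∷_)) x 0 lt
sumAbove-low φ (false ∷ x) (suc k) lt       =
  cong₂ _+_ (sumAbove-low (φ ∘ (false ∷_)) x (suc k) lt)
            (sumAbove-low (φ ∘ (true ∷_)) x k (<-trans (n<1+n k) lt))

sumAbove-high : ∀ φ x k → length x < k → sumAbove φ x k ≡ 0
sumAbove-high φ []          (suc k) lt       = refl
sumAbove-high φ (true ∷ x)  (suc k) (s≤s lt) = sumAbove-high (φ ∘ (true ∷_)) x k lt
sumAbove-high φ (false ∷ x) (suc k) (s≤s lt) =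
  cong₂ _+_ (sumAbove-high (φ ∘ (false ∷_)) x (suc k) (m≤n⇒m≤1+n lt)) (sumAbove-high (φ ∘ (true ∷_)) x k lt)

-- The sets in question arise by adding o of the o + f missing elements; deciding the first missing
-- one is Pascal's rule. At the ends of the row one of the two branches is empty.
sumAbove-const : ∀ φ c x o f k → k ≡ card x + o → zeros x ≡ o + f →
  (∀ y → length y ≡ length x → card y ≡ k → φ y ≡ c) → sumAbove φ x k ≡ binom o f * c
sumAbove-const φ c [] zero zero k refl eq h = trans (h [] refl refl) (sym (+-identityʳ c))
sumAbove-const φ c (true ∷ x) o f (suc k) k≡ eq h =
  sumAbove-const (φ ∘ (true ∷_)) c x o f k (suc-injective k≡) eq (λ y l≡ c≡ → h (true ∷ y) (cong suc l≡) (cong suc c≡))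
sumAbove-const φ c (false ∷ x) zero (suc f) zero k≡ eq h =
  sumAbove-const (φ ∘ (false ∷_)) c x zero f zero k≡ (suc-injective eq) (λ y l≡ c≡ → h (false ∷ y) (cong suc l≡) c≡)
sumAbove-const φ c (false ∷ x) zero (suc f) (suc k) k≡ eq h = trans (cong₂ _+_
  (sumAbove-const (φ ∘ (false ∷_)) c x zero f (suc k) k≡ (suc-injective eq) (λ y l≡ c≡ → h (false ∷ y) (cong suc l≡) c≡))
  (sumAbove-low (φ ∘ (true ∷_)) x k (≤-reflexive (trans k≡ (+-identityʳ _))))) (+-identityʳ _)
sumAbove-const φ c (false ∷ x) (suc o) f zero k≡ eq h with trans k≡ (+-suc (card x) o)
... | ()
sumAbove-const φ c (false ∷ x) (suc o) zero (suc k) k≡ eq h = cong₂ _+_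
  (sumAbove-high (φ ∘ (false ∷_)) x (suc k) (≤-reflexive (begin
    suc (length x)                ≡⟨ cong suc (card+zeros x) ⟨
    suc (card x + zeros x)        ≡⟨ +-suc (card x) (zeros x) ⟨
    card x + suc (zeros x)        ≡⟨ cong (card x +_) (trans eq (+-identityʳ (suc o))) ⟩
    card x + suc o                ≡⟨ k≡ ⟨
    suc k                         ∎)))
  (trans (sumAbove-const (φ ∘ (true ∷_)) c x o zero k (suc-injective (trans k≡ (+-suc (card x) o))) (suc-injective eq)
           (λ y l≡ c≡ → h (true ∷ y) (cong suc l≡) (cong suc c≡)))
         (cong (_* c) (binom-zeroʳ o)))
  where open ≡-Reasoning
sumAbove-const φ c (false ∷ x) (suc o) (suc f) (suc k) k≡ eq h = begin
  sumAbove (φ ∘ (false ∷_)) x (suc k) + sumAbove (φ ∘ (true ∷_)) x k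
    ≡⟨ cong₂ _+_
         (sumAbove-const (φ ∘ (false ∷_)) c x (suc o) f (suc k) k≡ (trans (suc-injective eq) (+-suc o f))
           (λ y l≡ c≡ → h (false ∷ y) (cong suc l≡) c≡))
         (sumAbove-const (φ ∘ (true ∷_)) c x o (suc f) k (suc-injective (trans k≡ (+-suc (card x) o))) (suc-injective eq)
           (λ y l≡ c≡ → h (true ∷ y) (cong suc l≡) (cong suc c≡))) ⟩
  binom (suc o) f * c + binom o (suc f) * c
    ≡⟨ +-comm (binom (suc o) f * c) _ ⟩
  binom o (suc f) * c + binom (suc o) f * c
    ≡⟨ *-distribʳ-+ c (binom o (suc f)) (binom (suc o) f) ⟨
  binom (suc o) (suc f) * c ∎
  where open ≡-Reasoning

-- The number of flags with rank set S when the first letter of S stands for a rank that lies o above the bottom.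
flagCount : ℕ → List Bool → ℕ
flagCount o []          = 1
flagCount o (false ∷ S) = flagCount (suc o) S
flagCount o (true ∷ S)  = binom o (suc (length S)) * flagCount 1 S

-- Only the distance o from x to the next rank matters. The last hypothesis says that the letters of
-- S run up to the rank just below the top.
chainCount-flagCount : ∀ S N x i o → length x ≡ N → i ≡ card x + o → zeros x ≡ o + length S →
  chainCount N x (ranksFrom i S) ≡ flagCount o S
chainCount-flagCount []          N x i o len≡ i≡ z≡ = refl
chainCount-flagCount (false ∷ S) N x i o len≡ i≡ z≡ =
  chainCount-flagCount S N x (suc i) (suc o) len≡ (trans (cong suc i≡) (sym (+-suc (card x) o))) (trans z≡ (+-suc o _))
chainCount-flagCount (true ∷ S)  .(length x) x i o refl i≡ z≡ =
  trans (sumIf≡sumAbove (λ y → chainCount (length x) y (ranksFrom (suc i) S)) x i)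
        (sumAbove-const _ (flagCount 1 S) x o (suc (length S)) i i≡ z≡ above)
  where
  open ≡-Reasoning
  above : ∀ y → length y ≡ length x → card y ≡ i →
          chainCount (length x) y (ranksFrom (suc i) S) ≡ flagCount 1 S
  above y len≡ card≡ = chainCount-flagCount S (length x) y (suc i) 1 len≡
    (trans (cong suc (sym card≡)) (+-comm 1 (card y)))
    (+-cancelˡ-≡ (card y) _ _ (begin
      card y + zeros y                   ≡⟨ card+zeros y ⟩
      length y                           ≡⟨ len≡ ⟩
      length x                           ≡⟨ card+zeros x ⟨
      card x + zeros x                   ≡⟨ cong (card x +_) z≡ ⟩
      card x + (o + suc (length S))      ≡⟨ +-assoc (card x) o _ ⟨
      card x + o + suc (length S)        ≡⟨ cong (_+ suc (length S)) (trans (sym i≡) (sym card≡)) ⟩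
      card y + suc (length S)            ∎))

fB≡flagCount : ∀ S → fB S ≡ flagCount 1 S
fB≡flagCount S = chainCount-flagCount S _ (bottom n) 1 1 (length-replicate n) (cong (_+ 1) (sym (card-bottom n))) (zeros-bottom n)
  where
  n = suc (length S)
  bottom : ℕ → List Bool
  bottom k = replicate k false
  card-bottom : ∀ k → card (bottom k) ≡ 0
  card-bottom zero    = refl
  card-bottom (suc k) = card-bottom k
  zeros-bottom : ∀ k → zeros (bottom k) ≡ k
  zeros-bottom zero    = refl
  zeros-bottom (suc k) = cong suc (zeros-bottom k)

as : ℕ → List Bool
as j = replicate j false

flagCount-b : ∀ o j S → flagCount o (as j ++ true ∷ S) ≡ binom (j + o) (suc (length S)) * flagCount 1 S
flagCount-b o zero    S = refl
flagCount-b o (suc j) S =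
  trans (flagCount-b (suc o) j S) (cong (λ n → binom n (suc (length S)) * flagCount 1 S) (+-suc j o))

flagCount-as : ∀ o j → flagCount o (as j) ≡ 1
flagCount-as o zero    = refl
flagCount-as o (suc j) = flagCount-as (suc o) j

-- The interval above the element of lowest chosen rank is again Boolean, of rank `suc (length S)`.
fB-b : ∀ j S → fB (as j ++ true ∷ S) ≡ binom (suc j) (suc (length S)) * fB S
fB-b j S = begin
  fB (as j ++ true ∷ S)                              ≡⟨ fB≡flagCount (as j ++ true ∷ S) ⟩
  flagCount 1 (as j ++ true ∷ S)                     ≡⟨ flagCount-b 1 j S ⟩
  binom (j + 1) (suc (length S)) * flagCount 1 S     ≡⟨ cong₂ (λ a b → binom a (suc (length S)) * b) (+-comm j 1) (sym (fB≡flagCount S)) ⟩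
  binom (suc j) (suc (length S)) * fB S              ∎
  where open ≡-Reasoning

-- The flag h-vector

-- Inclusion and exclusion performed one rank at a time, which turns the flag f-vector into the flag
-- h-vector.
alternating : (List Bool → ℤ.ℤ) → List Bool → ℤ.ℤ
alternating φ []          = φ []
alternating φ (false ∷ S) = alternating (φ ∘ (false ∷_)) S
alternating φ (true ∷ S)  = alternating (φ ∘ (true ∷_)) S ℤ.- alternating (φ ∘ (false ∷_)) S

subset-card : ∀ T S → subsetᵇ T S ≡ true → card T ≤ card S
subset-card []          []          _ = z≤n
subset-card (true ∷ T)  (true ∷ S)  h = s≤s (subset-card T S h)
subset-card (false ∷ T) (true ∷ S)  h = m≤n⇒m≤1+n (subset-card T S h)
subset-card (false ∷ T) (false ∷ S) h = subset-card T S h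
subset-card (true ∷ T)  (false ∷ S) ()

sign-suc : ∀ k → sign (suc k) ≡ ℤ.- sign k
sign-suc zero          = refl
sign-suc (suc zero)    = refl
sign-suc (suc (suc k)) = sign-suc k

sumIfℤ-neg : {B : Set} (p : B → Bool) (f : B → ℤ.ℤ) (xs : List B) → sumIfℤ p (λ x → ℤ.- f x) xs ≡ ℤ.- sumIfℤ p f xs
sumIfℤ-neg p f []       = refl
sumIfℤ-neg p f (x ∷ xs) with p x
... | true  = trans (cong (λ s → (ℤ.- f x) ℤ.+ s) (sumIfℤ-neg p f xs)) (sym (ℤ.neg-distrib-+ (f x) _))
... | false = sumIfℤ-neg p f xs

signed : List Bool → (List Bool → ℤ.ℤ) → List Bool → ℤ.ℤ
signed S φ T = sign (card S ∸ card T) ℤ.* φ T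

sumIf≡alternating : ∀ φ S → sumIfℤ (λ T → subsetᵇ T S) (signed S φ) (allWords (length S)) ≡ alternating φ S
sumIf≡alternating φ [] = trans (ℤ.+-identityʳ _) (ℤ.*-identityˡ (φ []))
sumIf≡alternating φ (b ∷ S) =
  trans (sumIfℤ-++ (λ T → subsetᵇ T (b ∷ S)) (signed (b ∷ S) φ) (map (false ∷_) ws) (map (true ∷_) ws))
  (trans (cong₂ ℤ._+_ (sumIfℤ-map (λ T → subsetᵇ T (b ∷ S)) (signed (b ∷ S) φ) (false ∷_) ws)
                      (sumIfℤ-map (λ T → subsetᵇ T (b ∷ S)) (signed (b ∷ S) φ) (true ∷_) ws)) (go b))
  where
  ws = allWords (length S)
  go : ∀ b → sumIfℤ (λ T → subsetᵇ (false ∷ T) (b ∷ S)) (λ T → signed (b ∷ S) φ (false ∷ T)) ws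
             ℤ.+ sumIfℤ (λ T → subsetᵇ (true ∷ T) (b ∷ S)) (λ T → signed (b ∷ S) φ (true ∷ T)) ws
             ≡ alternating φ (b ∷ S)
  go false = trans (cong₂ ℤ._+_ (sumIf≡alternating (φ ∘ (false ∷_)) S) (sumIfℤ-none ws (λ _ → refl))) (ℤ.+-identityʳ _)
  go true = begin
    sumIfℤ (λ T → subsetᵇ T S) (λ T → signed (true ∷ S) φ (false ∷ T)) ws
      ℤ.+ sumIfℤ (λ T → subsetᵇ T S) (signed S (φ ∘ (true ∷_))) ws
      ≡⟨ cong₂ ℤ._+_ negated (sumIf≡alternating (φ ∘ (true ∷_)) S) ⟩
    (ℤ.- alternating (φ ∘ (false ∷_)) S) ℤ.+ alternating (φ ∘ (true ∷_)) S
      ≡⟨ ℤ.+-comm (ℤ.- alternating (φ ∘ (false ∷_)) S) _ ⟩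
    alternating φ (true ∷ S) ∎
    where
    open ≡-Reasoning
    flip : ∀ T → subsetᵇ T S ≡ true → signed (true ∷ S) φ (false ∷ T) ≡ ℤ.- signed S (φ ∘ (false ∷_)) T
    flip T T⊆S = begin
      sign (suc (card S) ∸ card T) ℤ.* φ (false ∷ T)
        -- The truncated difference commutes with `suc` only because T has at most as many elements
        -- as S.
        ≡⟨ cong (λ n → sign n ℤ.* φ (false ∷ T)) (+-∸-assoc 1 (subset-card T S T⊆S)) ⟩
      sign (suc (card S ∸ card T)) ℤ.* φ (false ∷ T)
        ≡⟨ cong (ℤ._* φ (false ∷ T)) (sign-suc (card S ∸ card T)) ⟩
      (ℤ.- sign (card S ∸ card T)) ℤ.* φ (false ∷ T)
        ≡⟨ ℤ.neg-distribˡ-* (sign (card S ∸ card T)) _ ⟨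
      ℤ.- signed S (φ ∘ (false ∷_)) T ∎
    negated : sumIfℤ (λ T → subsetᵇ T S) (λ T → signed (true ∷ S) φ (false ∷ T)) ws
              ≡ ℤ.- alternating (φ ∘ (false ∷_)) S
    negated = trans (sumIfℤ-cong ws (λ _ → refl) flip)
             (trans (sumIfℤ-neg (λ T → subsetᵇ T S) (signed S (φ ∘ (false ∷_))) ws)
                    (cong ℤ.-_ (sumIf≡alternating (φ ∘ (false ∷_)) S)))

hB≡alternating : ∀ S → hB S ≡ alternating (λ T → ℤ.+ fB T) S
hB≡alternating S = sumIf≡alternating (λ T → ℤ.+ fB T) S

alternating-scale : ∀ {φ ψ} c S → (∀ T → length T ≡ length S → φ T ≡ c ℤ.* ψ T) → alternating φ S ≡ c ℤ.* alternating ψ S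
alternating-scale c []          h = h [] refl
alternating-scale c (false ∷ S) h = alternating-scale c S (λ T eq → h (false ∷ T) (cong suc eq))
alternating-scale {φ} {ψ} c (true ∷ S) h = begin
  alternating (φ ∘ (true ∷_)) S ℤ.- alternating (φ ∘ (false ∷_)) S
    ≡⟨ cong₂ ℤ._-_ (alternating-scale c S (λ T eq → h (true ∷ T) (cong suc eq)))
                   (alternating-scale c S (λ T eq → h (false ∷ T) (cong suc eq))) ⟩
  c ℤ.* alternating (ψ ∘ (true ∷_)) S ℤ.- c ℤ.* alternating (ψ ∘ (false ∷_)) S
    ≡⟨ regroup c (alternating (ψ ∘ (true ∷_)) S) _ ⟩
  c ℤ.* (alternating (ψ ∘ (true ∷_)) S ℤ.- alternating (ψ ∘ (false ∷_)) S) ∎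
  where
  open ≡-Reasoning
  regroup : ∀ c x y → c ℤ.* x ℤ.- c ℤ.* y ≡ c ℤ.* (x ℤ.- y)
  regroup = ℤ.solve-∀

alternating-as : ∀ φ j S → alternating φ (as j ++ S) ≡ alternating (λ T → φ (as j ++ T)) S
alternating-as φ zero    S = refl
alternating-as φ (suc j) S = alternating-as (φ ∘ (false ∷_)) j S

as-snoc : ∀ j S → as j ++ false ∷ S ≡ as (suc j) ++ S
as-snoc zero    S = refl
as-snoc (suc j) S = cong (false ∷_) (as-snoc j S)

-- Adding the two entries undoes the inclusion and exclusion at rank j + 1. That rank then occurs in
-- every chain, and `fB-b` factors out its binomial.
hB-relation : ∀ j S → hB (as j ++ true ∷ S) ℤ.+ hB (as (suc j) ++ S) ≡ ℤ.+ binom (suc j) (suc (length S)) ℤ.* hB S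
hB-relation j S = begin
  hB (as j ++ true ∷ S) ℤ.+ hB (as (suc j) ++ S)
    ≡⟨ cong (λ w → hB (as j ++ true ∷ S) ℤ.+ hB w) (as-snoc j S) ⟨
  hB (as j ++ true ∷ S) ℤ.+ hB (as j ++ false ∷ S)
    ≡⟨ cong₂ ℤ._+_ (trans (hB≡alternating (as j ++ true ∷ S)) (alternating-as _ j (true ∷ S)))
                   (trans (hB≡alternating (as j ++ false ∷ S)) (alternating-as _ j (false ∷ S))) ⟩
  (alternating (f true) S ℤ.- alternating (f false) S) ℤ.+ alternating (f false) S
    ≡⟨ regroup (alternating (f true) S) _ ⟩
  alternating (f true) S
    ≡⟨ alternating-scale c S scaled ⟩
  c ℤ.* alternating (λ T → ℤ.+ fB T) S
    ≡⟨ cong (c ℤ.*_) (hB≡alternating S) ⟨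
  c ℤ.* hB S ∎
  where
  open ≡-Reasoning
  c = ℤ.+ binom (suc j) (suc (length S))
  f : Bool → List Bool → ℤ.ℤ
  f b T = ℤ.+ fB (as j ++ b ∷ T)
  regroup : ∀ x y → (x ℤ.- y) ℤ.+ y ≡ x
  regroup = ℤ.solve-∀
  scaled : ∀ T → length T ≡ length S → f true T ≡ c ℤ.* ℤ.+ fB T
  scaled T len≡ = trans (cong ℤ.+_ (trans (fB-b j T) (cong (λ n → binom (suc j) (suc n) * fB T) len≡)))
                        (ℤ.pos-* (binom (suc j) (suc (length S))) (fB T))

hB-as : ∀ j → hB (as j) ≡ ℤ.+ 1
hB-as j = begin
  hB (as j)                                           ≡⟨ hB≡alternating (as j) ⟩
  alternating (λ T → ℤ.+ fB T) (as j)                 ≡⟨ only-as (λ T → ℤ.+ fB T) j ⟩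
  ℤ.+ fB (as j)                                       ≡⟨ cong ℤ.+_ (trans (fB≡flagCount (as j)) (flagCount-as 1 j)) ⟩
  ℤ.+ 1                                               ∎
  where
  open ≡-Reasoning
  only-as : ∀ φ j → alternating φ (as j) ≡ φ (as j)
  only-as φ zero    = refl
  only-as φ (suc j) = only-as (φ ∘ (false ∷_)) j

-- Expansion of cd-polynomials into ab-words

inc : List ℕ → List ℕ
inc []      = []
inc (p ∷ r) = suc p ∷ r

module Expansion {A : Set} (_⊕_ : A → A → A) (0# : A) where

  -- The coefficient of an ab-word in the expansion of Σ φ(v) v; the first letter of v is c, or it
  -- is d, which is only possible if the first two letters of the ab-word differ.
  expand : (List ℕ → A) → List Bool → A
  expand φ []          = φ (0 ∷ [])
  expand φ (x ∷ [])    = φ (1 ∷ [])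
  expand φ (x ∷ y ∷ w) = expand (φ ∘ inc) (y ∷ w) ⊕ (if x xor y then expand (φ ∘ (0 ∷_)) w else 0#)

  expand-cong : ∀ {φ ψ} w → (∀ p r → deg (p ∷ r) ≡ length w → φ (p ∷ r) ≡ ψ (p ∷ r)) → expand φ w ≡ expand ψ w
  expand-cong []          h = h 0 [] refl
  expand-cong (x ∷ [])    h = h 1 [] refl
  expand-cong (x ∷ y ∷ w) h = cong₂ _⊕_
    (expand-cong (y ∷ w) (λ p r eq → h (suc p) r (cong suc eq)))
    (cong (if x xor y then_else 0#) (expand-cong w (λ p r eq → h 0 (p ∷ r) (cong (2 +_) eq))))

open Expansion _+_ 0 using () renaming (expand to expandℕ; expand-cong to expandℕ-cong)
open Expansion ℤ._+_ (ℤ.+ 0) using () renaming (expand to expandℤ)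

expand-pos : ∀ φ w → expandℤ (λ v → ℤ.+ φ v) w ≡ ℤ.+ expandℕ φ w
expand-pos φ []          = refl
expand-pos φ (x ∷ [])    = refl
expand-pos φ (x ∷ y ∷ w) = cong₂ ℤ._+_ (expand-pos (φ ∘ inc) (y ∷ w)) (choice (x xor y) (expand-pos (φ ∘ (0 ∷_)) w))
  where
  choice : ∀ b {i n} → i ≡ ℤ.+ n → (if b then i else ℤ.+ 0) ≡ ℤ.+ (if b then n else 0)
  choice true  eq = eq
  choice false eq = refl

expand-rel : {_~_ : ℕ → ℕ → Set} → Additive _~_ → ∀ {φ ψ} w →
  (∀ p r → deg (p ∷ r) ≡ length w → φ (p ∷ r) ~ ψ (p ∷ r)) → expandℕ φ w ~ expandℕ ψ w
expand-rel add []          h = h 0 [] refl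
expand-rel add (x ∷ [])    h = h 1 [] refl
expand-rel {_~_} add (x ∷ y ∷ w) h = Additive.plus~ add
  (expand-rel add (y ∷ w) (λ p r eq → h (suc p) r (cong suc eq)))
  (choice (x xor y) (expand-rel add w (λ p r eq → h 0 (p ∷ r) (cong (2 +_) eq))))
  where
  choice : ∀ b {m n} → m ~ n → (if b then m else 0) ~ (if b then n else 0)
  choice true  m~n = m~n
  choice false m~n = Additive.zero~ add

expand-+ : ∀ φ ψ w → expandℕ (λ v → φ v + ψ v) w ≡ expandℕ φ w + expandℕ ψ w
expand-+ φ ψ []          = refl
expand-+ φ ψ (x ∷ [])    = refl
expand-+ φ ψ (x ∷ y ∷ w) =
  trans (cong₂ _+_ (expand-+ (φ ∘ inc) (ψ ∘ inc) (y ∷ w)) (choice (x xor y) (expand-+ (φ ∘ (0 ∷_)) (ψ ∘ (0 ∷_)) w)))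
        (interchange₂ (expandℕ (φ ∘ inc) (y ∷ w)) _ _ _)
  where
  choice : ∀ b {l m n} → l ≡ m + n → (if b then l else 0) ≡ (if b then m else 0) + (if b then n else 0)
  choice true  eq = eq
  choice false eq = refl

expand-0 : ∀ w → expandℕ (λ _ → 0) w ≡ 0
expand-0 w = expand-rel (scaled-additive 0) {ψ = λ _ → 0} w (λ _ _ _ → refl)

expand-decHead : ∀ φ x w → expandℕ (decHead φ) (x ∷ w) ≡ expandℕ φ w
expand-decHead φ x []      = refl
expand-decHead φ x (y ∷ w) = trans
  (cong₂ _+_ (expandℕ-cong (y ∷ w) (λ _ _ _ → refl))
             (trans (cong (if x xor y then_else 0) (expand-0 w)) (constant (x xor y))))
  (+-identityʳ _)
  where
  constant : ∀ b → (if b then 0 else 0) ≡ 0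
  constant true  = refl
  constant false = refl

expand-first : ∀ φ w →
  expandℕ φ (true ∷ w) + expandℕ φ (false ∷ w) ≡ expandℕ (joint φ (0 ∷ [])) w
expand-first φ [] = regroup (φ (1 ∷ []))
  where
  regroup : ∀ a → a + a ≡ a + (a + 0) + 0 + 0
  regroup = solve-∀
expand-first φ (y ∷ w) = begin
  expandℕ φ (true ∷ y ∷ w) + expandℕ φ (false ∷ y ∷ w)
    ≡⟨ one-differs y ⟩
  2 * expandℕ (φ ∘ inc) (y ∷ w) + expandℕ (φ ∘ (0 ∷_)) w
    ≡⟨ cong₂ _+_ (expand-rel (scaled-additive 2) {ψ = φ ∘ inc} (y ∷ w) (λ _ _ _ → refl)) (expand-decHead (φ ∘ (0 ∷_)) y w) ⟨
  expandℕ (λ v → 2 * φ (inc v)) (y ∷ w) + expandℕ (decHead (φ ∘ (0 ∷_))) (y ∷ w)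
    ≡⟨ expand-+ (λ v → 2 * φ (inc v)) (decHead (φ ∘ (0 ∷_))) (y ∷ w) ⟨
  expandℕ (λ v → 2 * φ (inc v) + decHead (φ ∘ (0 ∷_)) v) (y ∷ w)
    ≡⟨ expandℕ-cong (y ∷ w) (λ p r _ → sym (+-identityʳ _)) ⟩
  expandℕ (joint φ (0 ∷ [])) (y ∷ w) ∎
  where
  open ≡-Reasoning
  regroup₁ : ∀ a b → (a + 0) + (a + b) ≡ 2 * a + b
  regroup₁ = solve-∀
  regroup₂ : ∀ a b → (a + b) + (a + 0) ≡ 2 * a + b
  regroup₂ = solve-∀
  one-differs : ∀ y → expandℕ φ (true ∷ y ∷ w) + expandℕ φ (false ∷ y ∷ w)
                      ≡ 2 * expandℕ (φ ∘ inc) (y ∷ w) + expandℕ (φ ∘ (0 ∷_)) w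
  one-differs true  = regroup₁ (expandℕ (φ ∘ inc) (true ∷ w)) _
  one-differs false = regroup₂ (expandℕ (φ ∘ inc) (false ∷ w)) _

-- The letter after a^j is left free, and no d fits inside a^j. A c at the free place counts twice;
-- a d starting there fits exactly one of the two choices, and so does a d ending there. These are
-- the three terms of `joint`.
expand-joint : ∀ φ j w →
  expandℕ φ (as j ++ true ∷ w) + expandℕ φ (as (suc j) ++ w) ≡ expandℕ (joint φ (j ∷ [])) w
expand-joint φ zero    w = expand-first φ w
expand-joint φ (suc zero) w = begin
  (expandℕ (φ ∘ inc) (true ∷ w) + expandℕ (φ ∘ (0 ∷_)) w) + (expandℕ (φ ∘ inc) (false ∷ w) + 0)
    ≡⟨ regroup (expandℕ (φ ∘ inc) (true ∷ w)) (expandℕ (φ ∘ (0 ∷_)) w) _ ⟩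
  (expandℕ (φ ∘ inc) (true ∷ w) + expandℕ (φ ∘ inc) (false ∷ w)) + expandℕ (φ ∘ (0 ∷_)) w
    ≡⟨ cong (_+ expandℕ (φ ∘ (0 ∷_)) w) (expand-first (φ ∘ inc) w) ⟩
  expandℕ (joint (φ ∘ inc) (0 ∷ [])) w + expandℕ (φ ∘ (0 ∷_)) w
    ≡⟨ expand-+ (joint (φ ∘ inc) (0 ∷ [])) (φ ∘ (0 ∷_)) w ⟨
  expandℕ (λ v → joint (φ ∘ inc) (0 ∷ []) v + φ (0 ∷ v)) w
    ≡⟨ expandℕ-cong w (λ q r _ → cong (_+ φ (0 ∷ q ∷ r)) (trans (+-identityʳ _)
         (cong (2 * φ (suc (suc q) ∷ r) +_) (lowered q r)))) ⟩
  expandℕ (joint φ (1 ∷ [])) w ∎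
  where
  open ≡-Reasoning
  regroup : ∀ a b c → (a + b) + (c + 0) ≡ (a + c) + b
  regroup = solve-∀
  lowered : ∀ q r → dec (φ ∘ inc ∘ (0 ∷_)) q r ≡ dec (φ ∘ (1 ∷_)) q r
  lowered zero    r = refl
  lowered (suc q) r = refl
expand-joint φ (suc (suc j)) w = begin
  (expandℕ (φ ∘ inc) (as (suc j) ++ true ∷ w) + 0) + (expandℕ (φ ∘ inc) (as (suc (suc j)) ++ w) + 0)
    ≡⟨ cong₂ _+_ (+-identityʳ (expandℕ (φ ∘ inc) (as (suc j) ++ true ∷ w)))
                 (+-identityʳ (expandℕ (φ ∘ inc) (as (suc (suc j)) ++ w))) ⟩
  expandℕ (φ ∘ inc) (as (suc j) ++ true ∷ w) + expandℕ (φ ∘ inc) (as (suc (suc j)) ++ w)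
    ≡⟨ expand-joint (φ ∘ inc) (suc j) w ⟩
  expandℕ (joint (φ ∘ inc) (suc j ∷ [])) w
    ≡⟨ expandℕ-cong w (λ q r _ → cong (λ x → 2 * φ (suc (suc (suc j + q)) ∷ r) + x + φ (suc j ∷ q ∷ r)) (lowered q r)) ⟩
  expandℕ (joint φ (suc (suc j) ∷ [])) w ∎
  where
  open ≡-Reasoning
  lowered : ∀ q r → dec (φ ∘ inc ∘ (suc j ∷_)) q r ≡ dec (φ ∘ (suc (suc j) ∷_)) q r
  lowered zero    r = refl
  lowered (suc q) r = refl

expand-β₀-relation : ∀ j w → expandℕ β₀ (as j ++ true ∷ w) + expandℕ β₀ (as (suc j) ++ w)
                             ≡ binom (suc j) (suc (length w)) * expandℕ β₀ w
expand-β₀-relation j w = trans (expand-joint β₀ j w)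
  (expand-rel (scaled-additive (binom (suc j) (suc (length w)))) {ψ = β₀} w λ q r eq → begin
    joint β₀ (j ∷ []) (q ∷ r)
      ≡⟨ β₀-coproduct j [] q r ⟩
    binom (suc (j + 0)) (suc (deg (q ∷ r))) * (β₀ (j ∷ []) * β₀ (q ∷ r))
      ≡⟨ cong₂ (λ a b → binom (suc a) (suc b) * (β₀ (j ∷ []) * β₀ (q ∷ r))) (+-identityʳ j) eq ⟩
    binom (suc j) (suc (length w)) * (β₀ (j ∷ []) * β₀ (q ∷ r))
      ≡⟨ cong (λ x → binom (suc j) (suc (length w)) * (x * β₀ (q ∷ r))) (β₀-single j) ⟩
    binom (suc j) (suc (length w)) * (1 * β₀ (q ∷ r))
      ≡⟨ cong (binom (suc j) (suc (length w)) *_) (*-identityˡ (β₀ (q ∷ r))) ⟩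
    binom (suc j) (suc (length w)) * β₀ (q ∷ r) ∎)
  where open ≡-Reasoning

expand-as : ∀ φ j → expandℕ φ (as j) ≡ φ (j ∷ [])
expand-as φ zero          = refl
expand-as φ (suc zero)    = refl
expand-as φ (suc (suc j)) = trans (+-identityʳ _) (expand-as (φ ∘ inc) (suc j))

-- Read from the left, an a joins the prefix and a b is traded, by the common relation, for an a and
-- a shorter word.
hB≡expand-as : ∀ w j → hB (as j ++ w) ≡ ℤ.+ expandℕ β₀ (as j ++ w)
hB≡expand-as [] j = begin
  hB (as j ++ [])                   ≡⟨ cong hB (++-identityʳ (as j)) ⟩
  hB (as j)                         ≡⟨ hB-as j ⟩
  ℤ.+ 1                             ≡⟨ cong ℤ.+_ (trans (expand-as β₀ j) (β₀-single j)) ⟨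
  ℤ.+ expandℕ β₀ (as j)             ≡⟨ cong (λ w → ℤ.+ expandℕ β₀ w) (++-identityʳ (as j)) ⟨
  ℤ.+ expandℕ β₀ (as j ++ [])       ∎
  where open ≡-Reasoning
hB≡expand-as (false ∷ w) j =
  subst (λ x → hB x ≡ ℤ.+ expandℕ β₀ x) (sym (as-snoc j w)) (hB≡expand-as w (suc j))
hB≡expand-as (true ∷ w) j = ∙-cancelʳ (hB (as (suc j) ++ w)) _ _ (begin
  hB (as j ++ true ∷ w) ℤ.+ hB (as (suc j) ++ w)
    ≡⟨ hB-relation j w ⟩
  ℤ.+ c ℤ.* hB w
    ≡⟨ cong (λ z → ℤ.+ c ℤ.* z) (hB≡expand-as w 0) ⟩
  ℤ.+ c ℤ.* ℤ.+ expandℕ β₀ w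
    ≡⟨ ℤ.pos-* c (expandℕ β₀ w) ⟨
  ℤ.+ (c * expandℕ β₀ w)
    ≡⟨ cong ℤ.+_ (expand-β₀-relation j w) ⟨
  ℤ.+ (expandℕ β₀ (as j ++ true ∷ w)) ℤ.+ ℤ.+ expandℕ β₀ (as (suc j) ++ w)
    ≡⟨ cong (λ z → ℤ.+ expandℕ β₀ (as j ++ true ∷ w) ℤ.+ z) (hB≡expand-as w (suc j)) ⟨
  ℤ.+ (expandℕ β₀ (as j ++ true ∷ w)) ℤ.+ hB (as (suc j) ++ w) ∎)
  where
  open ≡-Reasoning
  c = binom (suc j) (suc (length w))

-- Uniqueness of the cd-index

-- An ab-word whose first two letters agree meets only cd-words beginning with c. Once these are
-- known, the words beginning with a b isolate the cd-words beginning with d.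
expand-injective : ∀ n {φ ψ : List ℕ → ℤ.ℤ} → (∀ w → length w ≡ n → expandℤ φ w ≡ expandℤ ψ w) →
  ∀ p r → deg (p ∷ r) ≡ n → φ (p ∷ r) ≡ ψ (p ∷ r)
expand-injective zero          h zero    []      eq = h [] refl
expand-injective (suc zero)    h (suc zero) []   eq = h (false ∷ []) refl
expand-injective (suc zero)    h (suc zero) (q ∷ r) ()
expand-injective (suc (suc n)) {φ} {ψ} h p r eq = go p r eq
  where
  incremented : ∀ y w → length w ≡ n → expandℤ (φ ∘ inc) (y ∷ w) ≡ expandℤ (ψ ∘ inc) (y ∷ w)
  incremented true  w eq = trans (sym (ℤ.+-identityʳ _)) (trans (h (true ∷ true ∷ w) (cong (2 +_) eq)) (ℤ.+-identityʳ _))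
  incremented false w eq = trans (sym (ℤ.+-identityʳ _)) (trans (h (false ∷ false ∷ w) (cong (2 +_) eq)) (ℤ.+-identityʳ _))
  go : ∀ p r → deg (p ∷ r) ≡ suc (suc n) → φ (p ∷ r) ≡ ψ (p ∷ r)
  go (suc p) r       eq = expand-injective (suc n) {φ ∘ inc} {ψ ∘ inc}
    (λ { (y ∷ w) eq → incremented y w (suc-injective eq) }) p r (suc-injective eq)
  go zero    (q ∷ r) eq = expand-injective n {φ ∘ (0 ∷_)} {ψ ∘ (0 ∷_)}
    (λ w eq → ∙-cancelˡ (expandℤ (φ ∘ inc) (true ∷ w)) _ _
      (trans (h (false ∷ true ∷ w) (cong (2 +_) eq))
             (cong (ℤ._+ expandℤ (ψ ∘ (0 ∷_)) w) (sym (incremented true w eq)))))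
    q r (suc-injective (suc-injective eq))

-- The enumeration of cd-words

sumOver : (List ℕ → ℤ.ℤ) → ℕ → ℕ → ℤ.ℤ
sumOver F fuel n = foldr ℤ._+_ (ℤ.+ 0) (map F (cdWordsF fuel n))

foldr-++ : ∀ {B : Set} (F : B → ℤ.ℤ) xs ys →
  foldr ℤ._+_ (ℤ.+ 0) (map F (xs ++ ys)) ≡ foldr ℤ._+_ (ℤ.+ 0) (map F xs) ℤ.+ foldr ℤ._+_ (ℤ.+ 0) (map F ys)
foldr-++ F []       ys = sym (ℤ.+-identityˡ _)
foldr-++ F (x ∷ xs) ys = trans (cong (λ z → F x ℤ.+ z) (foldr-++ F xs ys)) (sym (ℤ.+-assoc (F x) _ _))

foldr-concatMap : ∀ {B C : Set} (F : C → ℤ.ℤ) (g : B → List C) xs →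
  foldr ℤ._+_ (ℤ.+ 0) (map F (concatMap g xs)) ≡ foldr ℤ._+_ (ℤ.+ 0) (map (λ x → foldr ℤ._+_ (ℤ.+ 0) (map F (g x))) xs)
foldr-concatMap F g []       = refl
foldr-concatMap F g (x ∷ xs) =
  trans (foldr-++ F (g x) (concatMap g xs)) (cong (λ z → foldr ℤ._+_ (ℤ.+ 0) (map F (g x)) ℤ.+ z) (foldr-concatMap F g xs))

sumOver-suc : ∀ F fuel n → sumOver F (suc fuel) n
  ≡ F (n ∷ []) ℤ.+ sumIfℤ (λ p → (p + 2) ≤ᵇ n) (λ p → sumOver (F ∘ (p ∷_)) fuel (n ∸ 2 ∸ p)) (upTo n)
sumOver-suc F fuel n = cong (λ z → F (n ∷ []) ℤ.+ z) (trans
  (foldr-concatMap F (λ p → map (p ∷_) (cdWordsF fuel (n ∸ 2 ∸ p))) (filterᵇ (λ p → (p + 2) ≤ᵇ n) (upTo n)))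
  (sumIfℤ-cong (upTo n) (λ _ → refl) (λ p _ → cong (foldr ℤ._+_ (ℤ.+ 0)) (sym (map-∘ (cdWordsF fuel (n ∸ 2 ∸ p)))))))

sumOver-cong : ∀ {F G} fuel n → (∀ p r → F (p ∷ r) ≡ G (p ∷ r)) → sumOver F fuel n ≡ sumOver G fuel n
sumOver-cong zero       n h = cong (ℤ._+ ℤ.+ 0) (h n [])
sumOver-cong {F} {G} (suc fuel) n h = trans (sumOver-suc F fuel n) (trans
  (cong₂ ℤ._+_ (h n []) (sumIfℤ-cong (upTo n) (λ _ → refl) (λ p _ → sumOver-cong fuel (n ∸ 2 ∸ p) (λ q r → h p (q ∷ r)))))
  (sym (sumOver-suc G fuel n)))

-- The enumeration by first part is regrouped by first letter: `inc` prepends a c, and a new part 0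
-- prepends a d, which costs one unit of fuel.
sumOver-2+ : ∀ F fuel n → sumOver F (suc fuel) (suc (suc n))
  ≡ sumOver (F ∘ inc) (suc fuel) (suc n) ℤ.+ sumOver (F ∘ (0 ∷_)) fuel n
sumOver-2+ F fuel n = begin
  sumOver F (suc fuel) (2 + n)
    ≡⟨ sumOver-suc F fuel (2 + n) ⟩
  F (2 + n ∷ []) ℤ.+ sumIfℤ P f (0 ∷ applyUpTo suc (suc n))
    -- The degree is at least two, so the first part 0 passes the filter by computation.
    ≡⟨⟩
  F (2 + n ∷ []) ℤ.+ (f 0 ℤ.+ sumIfℤ P f (applyUpTo suc (suc n)))
    ≡⟨ cong (λ z → F (2 + n ∷ []) ℤ.+ (f 0 ℤ.+ z)) shifted ⟩
  F (2 + n ∷ []) ℤ.+ (f 0 ℤ.+ sumIfℤ P′ f′ (upTo (suc n)))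
    ≡⟨ regroup (F (2 + n ∷ [])) (f 0) _ ⟩
  (F (2 + n ∷ []) ℤ.+ sumIfℤ P′ f′ (upTo (suc n))) ℤ.+ f 0
    ≡⟨ cong (ℤ._+ f 0) (sumOver-suc (F ∘ inc) fuel (suc n)) ⟨
  sumOver (F ∘ inc) (suc fuel) (suc n) ℤ.+ sumOver (F ∘ (0 ∷_)) fuel n ∎
  where
  open ≡-Reasoning
  P P′ : ℕ → Bool
  P p = (p + 2) ≤ᵇ (2 + n)
  P′ p = (p + 2) ≤ᵇ suc n
  f f′ : ℕ → ℤ.ℤ
  f p = sumOver (F ∘ (p ∷_)) fuel (n ∸ p)
  f′ p = sumOver (F ∘ inc ∘ (p ∷_)) fuel (suc n ∸ 2 ∸ p)
  condition : ∀ p → P (suc p) ≡ P′ p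
  condition zero    = refl
  condition (suc p) = refl
  shifted : sumIfℤ P f (applyUpTo suc (suc n)) ≡ sumIfℤ P′ f′ (upTo (suc n))
  shifted = begin
    sumIfℤ P f (applyUpTo suc (suc n))
      ≡⟨ cong (sumIfℤ P f) (map-upTo suc (suc n)) ⟨
    sumIfℤ P f (map suc (upTo (suc n)))
      ≡⟨ sumIfℤ-map P f suc (upTo (suc n)) ⟩
    sumIfℤ (P ∘ suc) (f ∘ suc) (upTo (suc n))
      ≡⟨ sumIfℤ-cong (upTo (suc n)) condition (λ p _ → cong (sumOver (F ∘ (suc p ∷_)) fuel) (sym (∸-+-assoc n 1 p))) ⟩
    sumIfℤ P′ f′ (upTo (suc n)) ∎
  regroup : ∀ a b c → a ℤ.+ (b ℤ.+ c) ≡ (a ℤ.+ c) ℤ.+ b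
  regroup = ℤ.solve-∀

-- Coefficients of ab-words in a cd-word

count : (List Bool → Bool) → List (List Bool) → ℕ
count p xs = length (filterᵇ p xs)

count≡sumIf : ∀ p xs → count p xs ≡ sumIfℕ p (λ _ → 1) xs
count≡sumIf p []       = refl
count≡sumIf p (x ∷ xs) with p x
... | true  = cong suc (count≡sumIf p xs)
... | false = count≡sumIf p xs

count-map-++ : ∀ p (g h : List Bool → List Bool) xs →
  count p (map g xs ++ map h xs) ≡ count (p ∘ g) xs + count (p ∘ h) xs
count-map-++ p g h xs = begin
  count p (map g xs ++ map h xs)
    ≡⟨ count≡sumIf p (map g xs ++ map h xs) ⟩
  sumIfℕ p _ (map g xs ++ map h xs)
    ≡⟨ sumIfℕ-++ p _ (map g xs) (map h xs) ⟩
  sumIfℕ p _ (map g xs) + sumIfℕ p _ (map h xs)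
    ≡⟨ cong₂ _+_ (sumIfℕ-map p _ g xs) (sumIfℕ-map p _ h xs) ⟩
  sumIfℕ (p ∘ g) _ xs + sumIfℕ (p ∘ h) _ xs
    ≡⟨ cong₂ _+_ (count≡sumIf (p ∘ g) xs) (count≡sumIf (p ∘ h) xs) ⟨
  count (p ∘ g) xs + count (p ∘ h) xs ∎
  where open ≡-Reasoning

count-none : ∀ {p} xs → (∀ x → p x ≡ false) → count p xs ≡ 0
count-none xs none = trans (count≡sumIf _ xs) (sumIfℕ-none xs none)

abCoeff-c : ∀ p r x w → abCoeff (suc p ∷ r) (x ∷ w) ≡ abCoeff (p ∷ r) w
abCoeff-c p r x w = trans (cong (λ l → count (eqWord (x ∷ w)) (expandLetters l)) (letters-c r))
  (trans (count-map-++ (eqWord (x ∷ w)) (false ∷_) (true ∷_) E) (match x))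
  where
  E = expandLetters (letters (p ∷ r))
  letters-c : ∀ r → letters (suc p ∷ r) ≡ C ∷ letters (p ∷ r)
  letters-c []      = refl
  letters-c (q ∷ r) = refl
  match : ∀ x → count (λ y → eqWord (x ∷ w) (false ∷ y)) E + count (λ y → eqWord (x ∷ w) (true ∷ y)) E ≡ count (eqWord w) E
  match true  = cong (_+ count (eqWord w) E) (count-none E (λ _ → refl))
  match false = trans (cong (count (eqWord w) E +_) (count-none E (λ _ → refl))) (+-identityʳ _)

abCoeff-d : ∀ q r x y w → abCoeff (0 ∷ q ∷ r) (x ∷ y ∷ w) ≡ (if x xor y then abCoeff (q ∷ r) w else 0)
abCoeff-d q r x y w = trans (count-map-++ (eqWord (x ∷ y ∷ w)) (λ z → false ∷ true ∷ z) (λ z → true ∷ false ∷ z) E) (match x y)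
  where
  E = expandLetters (letters (q ∷ r))
  match : ∀ x y → count (λ z → eqWord (x ∷ y ∷ w) (false ∷ true ∷ z)) E + count (λ z → eqWord (x ∷ y ∷ w) (true ∷ false ∷ z)) E
                  ≡ (if x xor y then count (eqWord w) E else 0)
  match true  true  = cong₂ _+_ (count-none E (λ _ → refl)) (count-none E (λ _ → refl))
  match true  false = cong (_+ count (eqWord w) E) (count-none E (λ _ → refl))
  match false true  = trans (cong (count (eqWord w) E +_) (count-none E (λ _ → refl))) (+-identityʳ _)
  match false false = cong₂ _+_ (count-none E (λ _ → refl)) (count-none E (λ _ → refl))

-- The coefficients obey the same rule by first letter as the enumeration: a c matches any letter, a
-- d matches two letters that differ.
sumOver≡expand : ∀ φ fuel w → length w ≤ fuel →
  sumOver (λ v → φ v ℤ.* ℤ.+ abCoeff v w) fuel (length w) ≡ expandℤ φ w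
sumOver≡expand φ zero       []           le = trans (ℤ.+-identityʳ _) (ℤ.*-identityʳ _)
sumOver≡expand φ (suc fuel) []           le = trans (ℤ.+-identityʳ _) (ℤ.*-identityʳ _)
sumOver≡expand φ (suc fuel) (true ∷ [])  le = trans (ℤ.+-identityʳ _) (ℤ.*-identityʳ _)
sumOver≡expand φ (suc fuel) (false ∷ []) le = trans (ℤ.+-identityʳ _) (ℤ.*-identityʳ _)
sumOver≡expand φ (suc fuel) (x ∷ y ∷ w)  (s≤s le) = begin
  sumOver (λ v → φ v ℤ.* ℤ.+ abCoeff v (x ∷ y ∷ w)) (suc fuel) (2 + length w)
    ≡⟨ sumOver-2+ (λ v → φ v ℤ.* ℤ.+ abCoeff v (x ∷ y ∷ w)) fuel (length w) ⟩
  sumOver (λ v → φ (inc v) ℤ.* ℤ.+ abCoeff (inc v) (x ∷ y ∷ w)) (suc fuel) (suc (length w))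
    ℤ.+ sumOver (λ v → φ (0 ∷ v) ℤ.* ℤ.+ abCoeff (0 ∷ v) (x ∷ y ∷ w)) fuel (length w)
    ≡⟨ cong₂ ℤ._+_ (c-part (sumOver≡expand (φ ∘ inc) (suc fuel) (y ∷ w) (m≤n⇒m≤1+n le)))
                   (d-cases (x xor y) (λ q r → abCoeff-d q r x y w)
                     (sumOver≡expand (φ ∘ (0 ∷_)) fuel w (≤-trans (n≤1+n _) le))) ⟩
  expandℤ φ (x ∷ y ∷ w) ∎
  where
  open ≡-Reasoning
  c-part : sumOver (λ v → φ (inc v) ℤ.* ℤ.+ abCoeff v (y ∷ w)) (suc fuel) (suc (length w)) ≡ expandℤ (φ ∘ inc) (y ∷ w) →
           sumOver (λ v → φ (inc v) ℤ.* ℤ.+ abCoeff (inc v) (x ∷ y ∷ w)) (suc fuel) (suc (length w))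
           ≡ expandℤ (φ ∘ inc) (y ∷ w)
  c-part ih = trans
    (sumOver-cong {F = λ v → φ (inc v) ℤ.* ℤ.+ abCoeff (inc v) (x ∷ y ∷ w)}
                  {G = λ v → φ (inc v) ℤ.* ℤ.+ abCoeff v (y ∷ w)} (suc fuel) (suc (length w)) (λ p r → cong (λ n → φ (suc p ∷ r) ℤ.* ℤ.+ n) (abCoeff-c p r x (y ∷ w))))
    ih
  sumOver-0 : ∀ {F} fuel n → (∀ p r → F (p ∷ r) ≡ ℤ.+ 0) → sumOver F fuel n ≡ ℤ.+ 0
  sumOver-0 fuel n h = trans (sumOver-cong fuel n h) (all-0 (cdWordsF fuel n))
    where
    all-0 : ∀ vs → foldr ℤ._+_ (ℤ.+ 0) (map (λ _ → ℤ.+ 0) vs) ≡ ℤ.+ 0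
    all-0 []       = refl
    all-0 (v ∷ vs) = trans (ℤ.+-identityˡ _) (all-0 vs)
  d-cases : ∀ b → (∀ q r → abCoeff (0 ∷ q ∷ r) (x ∷ y ∷ w) ≡ (if b then abCoeff (q ∷ r) w else 0)) →
    sumOver (λ v → φ (0 ∷ v) ℤ.* ℤ.+ abCoeff v w) fuel (length w) ≡ expandℤ (φ ∘ (0 ∷_)) w →
    sumOver (λ v → φ (0 ∷ v) ℤ.* ℤ.+ abCoeff (0 ∷ v) (x ∷ y ∷ w)) fuel (length w)
      ≡ (if b then expandℤ (φ ∘ (0 ∷_)) w else ℤ.+ 0)
  d-cases true  h ih = trans
    (sumOver-cong {F = λ v → φ (0 ∷ v) ℤ.* ℤ.+ abCoeff (0 ∷ v) (x ∷ y ∷ w)}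
                  {G = λ v → φ (0 ∷ v) ℤ.* ℤ.+ abCoeff v w} fuel (length w) (λ q r → cong (λ n → φ (0 ∷ q ∷ r) ℤ.* ℤ.+ n) (h q r)))
    ih
  d-cases false h _ = sumOver-0 fuel (length w)
    (λ q r → trans (cong (λ n → φ (0 ∷ q ∷ r) ℤ.* ℤ.+ n) (h q r)) (ℤ.*-zeroʳ (φ (0 ∷ q ∷ r))))

-- Identification of β with `β₀`, and the two inequalities

cdIndex-unique : ∀ β → IsBooleanCdIndex β → ∀ p r → β (p ∷ r) ≡ ℤ.+ β₀ (p ∷ r)
cdIndex-unique β isCdIndex p r = expand-injective _ coefficients p r refl
  where
  open ≡-Reasoning
  coefficients : ∀ w → length w ≡ deg (p ∷ r) → expandℤ β w ≡ expandℤ (λ v → ℤ.+ β₀ v) w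
  coefficients w _ = begin
    expandℤ β w                                                            ≡⟨ sumOver≡expand β (length w) w ≤-refl ⟨
    sumOver (λ v → β v ℤ.* ℤ.+ abCoeff v w) (length w) (length w)          ≡⟨ isCdIndex w ⟩
    hB w                                                                   ≡⟨ hB≡expand-as w 0 ⟩
    ℤ.+ expandℕ β₀ w                                                       ≡⟨ expand-pos β₀ w ⟨
    expandℤ (λ v → ℤ.+ β₀ v) w                                             ∎

cdIndex-unique-++ : ∀ β → IsBooleanCdIndex β → ∀ u p r → β (u ++ p ∷ r) ≡ ℤ.+ β₀ (u ++ p ∷ r)
cdIndex-unique-++ β isCdIndex []      p r = cdIndex-unique β isCdIndex p r
cdIndex-unique-++ β isCdIndex (q ∷ u) p r = cdIndex-unique β isCdIndex q (u ++ p ∷ r)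

theorem7p3 : (β : List ℕ → ℤ.ℤ) → IsBooleanCdIndex β →
    (∀ (m n : ℕ) → m < n → ∀ (M : List ℕ) →
    (β (M ++ n ∷ m ∷ []) ℤ.≤ β (M ++ m ∷ n ∷ []))
    × (M ≡ [] → β (M ++ m ∷ n ∷ []) ≡ β (M ++ n ∷ m ∷ [])))
    × (∀ (m₁ n₁ m₂ n₂ : ℕ) → m₁ + n₁ ≡ m₂ + n₂ → ∣ m₁ - n₁ ∣ < ∣ m₂ - n₂ ∣ →
    ∀ (M N : List ℕ) → β (M ++ m₂ ∷ n₂ ∷ N) ℤ.< β (M ++ m₁ ∷ n₁ ∷ N))
theorem7p3 β isCdIndex =
  (λ m n m<n M →
      subst₂ ℤ._≤_ (sym (β≡ M n (m ∷ []))) (sym (β≡ M m (n ∷ []))) (ℤ.+≤+ (β₀-end-order M m n m<n))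
    , λ { refl → trans (β≡ [] m (n ∷ [])) (trans (cong ℤ.+_ (sym (β₀-swap [] m n []))) (sym (β≡ [] n (m ∷ [])))) })
  , λ m₁ n₁ m₂ n₂ sum≡ lt M N →
      subst₂ ℤ._<_ (sym (β≡ M m₂ (n₂ ∷ N))) (sym (β≡ M m₁ (n₁ ∷ N)))
        (ℤ.+<+ (β₀-strict sum≡ (closer m₁ n₁ m₂ n₂ sum≡ lt) M N))
  where β≡ = cdIndex-unique-++ β isCdIndex
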